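{- Let $\mathcal{T}_2$ denote the family of partial $2$-trees. Then (i) $14\le \chi_{0,3}(\mathcal{T}_2)\le 15$, and (ii) $14\le \chi_{1,1}(\mathcal{T}_2)\le 21$.
   Context: All graphs are finite. Partial $2$-trees are the simple graphs of treewidth at most $2$ (equivalently, $K_4$-minor-free graphs). An $(n,m)$-graph $G$ is a graph with $n$ types of arcs (labeled $2,4,\ldots,2n$) and $m$ types of edges (labeled $2n+1,\ldots,2n+m$), whose underlying undirected graph $\mathrm{und}(G)$ is simple (so each adjacent pair of distinct vertices is joined by exactly one arc or exactly one edge, with exactly one type, and there are no loops). Thus a $(0,3)$-graph is a simple graph with edges colored by three colors, and in a $(1,1)$-graph each adjacency is either an arc or an undirected edge. A homomorphism of an $(n,m)$-graph $G$ to an $(n,m)$-graph $H$ is a map $f:V(G)\to V(H)$ such that whenever $uv$ is an arc from $u$ to $v$ (resp. an edge) of type $\alpha$ in $G$, $f(u)f(v)$ is an arc from $f(u)$ to $f(v)$ (resp. an edge) of type $\alpha$ in $H$; write $G\to H$ if one exists. For an $(n,m)$-graph $G$, $\chi_{n,m}(G)=\min\{|V(H)|: H \text{ an } (n,m)\text{ -graph},\ G\to H\}$. For a simple graph $S$, $\chi_{n,m}(S)=\max\{\chi_{n,m}(G): \mathrm{und}(G)=S\}$. For a family $\mathcal{F}$ of graphs, $\chi_{n,m}(\mathcal{F})=\max\{\chi_{n,m}(G): G\in\mathcal{F}\}$. -}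

module Defs where

open import Data.Bool using (Bool; true; false; T)
open import Data.Fin using (Fin; zero; suc; inject₁; fromℕ)
open import Data.Fin.Subset using (Subset; _∈_; ∣_∣)
open import Data.Nat using (ℕ; suc; _+_; _≤_; NonZero)
open import Data.Product using (∃; _×_)
open import Function.Definitions using (Injective)
open import Relation.Binary.Construct.Closure.ReflexiveTransitive using (Star)
open import Relation.Binary.PropositionalEquality using (_≡_; refl; sym; trans; cong)
open import Relation.Nullary using (¬_)

record SimpleGraph (v : ℕ) : Set where
  field
    adj       : Fin v → Fin v → Bool
    loopless  : ∀ x → adj x x ≡ false
    symmetric : ∀ x y → adj x y ≡ adj y x

  Adj : Fin v → Fin v → Set
  Adj x y = T (adj x y)

record Cycle {v : ℕ} (S : SimpleGraph v) : Set where
  open SimpleGraph S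
  field
    length-3  : ℕ
    vertex    : Fin (3 + length-3) → Fin v
    distinct  : Injective _≡_ _≡_ vertex
    step      : ∀ (i : Fin (2 + length-3)) → Adj (vertex (inject₁ i)) (vertex (suc i))
    closing   : Adj (vertex (fromℕ (2 + length-3))) (vertex zero)

record IsTree {v : ℕ} (S : SimpleGraph v) : Set where
  open SimpleGraph S
  field
    nonEmpty  : NonZero v
    connected : ∀ x y → Star Adj x y
    acyclic   : ¬ Cycle S

record TreeDecomposition {v : ℕ} (S : SimpleGraph v) : Set where
  field
    nodes  : ℕ
    tree   : SimpleGraph nodes
    isTree : IsTree tree
    bag    : Fin nodes → Subset v

  -- Adjacency in the subgraph of the tree induced by the nodes whose bag
  -- contains x.
  AdjAt : Fin v → Fin nodes → Fin nodes → Set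
  AdjAt x i j = SimpleGraph.Adj tree i j × x ∈ bag i × x ∈ bag j

  field
    vertexCovered : ∀ x → ∃ λ i → x ∈ bag i
    edgeCovered   : ∀ x y → SimpleGraph.Adj S x y → ∃ λ i → x ∈ bag i × y ∈ bag i
    coherent      : ∀ x i j → x ∈ bag i → x ∈ bag j → Star (AdjAt x) i j

  WidthAtMost : ℕ → Set
  WidthAtMost k = ∀ i → ∣ bag i ∣ ≤ suc k

TreewidthAtMost : ℕ → {v : ℕ} → SimpleGraph v → Set
TreewidthAtMost k S = ∃ λ (D : TreeDecomposition S) → TreeDecomposition.WidthAtMost D k

GraphFamily : Set₁
GraphFamily = {v : ℕ} → SimpleGraph v → Set

Partial2Tree : GraphFamily
Partial2Tree = TreewidthAtMost 2

-- How an ordered pair (x , y) of vertices is joined: not at all, by an arc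
-- of some type from x to y, by an arc of some type from y to x, or by an
-- edge of some type.  Arc types and edge types are numbered from 0
-- separately, instead of by 2,4,…,2n and 2n+1,…,2n+m.
data Link (n m : ℕ) : Set where
  none    : Link n m
  arcTo   : Fin n → Link n m
  arcFrom : Fin n → Link n m
  edge    : Fin m → Link n m

reverse : ∀ {n m} → Link n m → Link n m
reverse none        = none
reverse (arcTo i)   = arcFrom i
reverse (arcFrom i) = arcTo i
reverse (edge j)    = edge j

joined : ∀ {n m} → Link n m → Bool
joined none        = false
joined (arcTo _)   = true
joined (arcFrom _) = true
joined (edge _)    = true

joined-reverse : ∀ {n m} (l : Link n m) → joined (reverse l) ≡ joined l
joined-reverse none        = refl
joined-reverse (arcTo _)   = refl
joined-reverse (arcFrom _) = refl
joined-reverse (edge _)    = refl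

-- An (n,m)-graph on v vertices.
record MixedGraph (n m v : ℕ) : Set where
  field
    link         : Fin v → Fin v → Link n m
    loopless     : ∀ x → link x x ≡ none
    link-reverse : ∀ x y → link y x ≡ reverse (link x y)

  Arc : Fin n → Fin v → Fin v → Set
  Arc i x y = link x y ≡ arcTo i

  Edge : Fin m → Fin v → Fin v → Set
  Edge j x y = link x y ≡ edge j

und : ∀ {n m v} → MixedGraph n m v → SimpleGraph v
und G = record
  { adj       = λ x y → joined (link x y)
  ; loopless  = λ x → cong joined (loopless x)
  ; symmetric = λ x y → sym (trans (cong joined (link-reverse x y)) (joined-reverse (link x y)))
  }
  where open MixedGraph G

-- Equality of simple graphs on the same vertex set, stated pointwise since
-- function extensionality is unavailable.
_≐_ : ∀ {v} → SimpleGraph v → SimpleGraph v → Set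
S ≐ S′ = ∀ x y → SimpleGraph.adj S x y ≡ SimpleGraph.adj S′ x y

record _⟶_ {n m v w : ℕ} (G : MixedGraph n m v) (H : MixedGraph n m w) : Set where
  private
    module G = MixedGraph G
    module H = MixedGraph H
  field
    map           : Fin v → Fin w
    preservesArc  : ∀ i x y → G.Arc i x y → H.Arc i (map x) (map y)
    preservesEdge : ∀ j x y → G.Edge j x y → H.Edge j (map x) (map y)

IsMinimum : (ℕ → Set) → ℕ → Set
IsMinimum P k = P k × (∀ j → P j → k ≤ j)

IsMaximum : (ℕ → Set) → ℕ → Set
IsMaximum P k = P k × (∀ j → P j → j ≤ k)

TargetOrder : ∀ {n m v} → MixedGraph n m v → ℕ → Set
TargetOrder {n} {m} G k = ∃ λ (H : MixedGraph n m k) → G ⟶ H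

χ-mixed : ∀ {n m v} → MixedGraph n m v → ℕ → Set
χ-mixed G = IsMinimum (TargetOrder G)

χ-simple : ∀ (n m : ℕ) {v} → SimpleGraph v → ℕ → Set
χ-simple n m {v} S =
  IsMaximum (λ k → ∃ λ (G : MixedGraph n m v) → und G ≐ S × χ-mixed G k)

χ-member : (n m : ℕ) → GraphFamily → ℕ → Set
χ-member n m F k = ∃ λ v → ∃ λ (S : SimpleGraph v) → F S × χ-simple n m S k

χ-family : (n m : ℕ) → GraphFamily → ℕ → Set
χ-family n m F = IsMaximum (χ-member n m F)

-- a ≤ χ_{n,m}(F) ≤ b.  The first component is the literal claim; its
-- existential is double negated because a constructive witness would
-- determine the exact value of χ_{n,m}(F), not merely bound it.  From it
-- the upper bound for every member of F follows constructively, but the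
-- witness for the lower bound does not, so that is required separately.
χ-family-between : (n m : ℕ) → GraphFamily → ℕ → ℕ → Set
χ-family-between n m F a b =
  (¬ ¬ ∃ λ k → χ-family n m F k × a ≤ k × k ≤ b) ×
  (∃ λ k → χ-member n m F k × a ≤ k)

{-# OPTIONS --safe #-}

-- Upper bounds.  Let H be a target in which every two adjacent vertices p, q
-- have, for all types a and b, a common neighbour c with pc of type a and qc
-- of type b.  Walking through a tree decomposition of width 2, every bag
-- contributes only vertices with at most two already coloured companions in
-- it, so a homomorphism to H can be extended greedily.
--
-- Lower bounds.  Stack apices of all 9 type pairs on every edge of a graph,
-- six times, starting from a single edge.  In a target of order at most 13,
-- the image of a deep edge at x forces 4 neighbours of x in each of the 3
-- types, hence order exactly 13, all pairs adjacent through deep edges, and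
-- the edges of one fixed edge type form a 4-regular graph in which every edge
-- lies in exactly one triangle.  The 26 edges would split into triples.

module Submission where

open import Data.Bool using (Bool; true; false; T; if_then_else_)
open import Data.Bool.Properties using (T?) renaming (_≟_ to _≟ᵇ_)
open import Data.Empty using (⊥; ⊥-elim)
open import Data.Fin using (Fin; zero; suc; toℕ; inject₁; fromℕ; combine; remQuot; finToFun; funToFin; join; splitAt; _<?_)
open import Data.Fin.Patterns using (0F; 1F; 2F; 3F)
open import Data.Fin.Permutation using (Permutation; permutation)
open import Data.Fin.Properties using (_≟_; any?; all?; suc-injective; injective⇒≤; combine-remQuot; finToFun-funToFin; splitAt-join)
open import Data.Fin.Subset using (Subset; inside; outside; _∈_; ∣_∣; ⁅_⁆; ⊤) renaming (_∪_ to _∪ˢ_)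
open import Data.Fin.Subset.Properties using (_∈?_; nonempty?; x∈⁅x⁆; x∈⁅y⁆⇒x≡y; x∈p∪q⁻; x∈p∪q⁺; ∣⁅x⁆∣≡1; ∈⊤)
open import Data.List using (List; []; _∷_; allFin; cartesianProduct)
open import Data.List.Membership.Propositional using (find; lose) renaming (_∈_ to _∈ˡ_)
open import Data.List.Membership.Propositional.Properties using (∈-allFin; ∈-cartesianProduct⁺)
import Data.List.Membership.DecPropositional as DecMembership
import Data.List.Relation.Unary.Any as ListAny
open import Data.List.Relation.Unary.Any using (here; there)
open import Data.Nat using (ℕ; zero; suc; _+_; _*_; _^_; _∸_; _≤_; _<_; z≤n; s≤s; NonZero)
import Data.Nat as ℕ
open import Data.Nat.Divisibility using (_∣_; _∣?_; divides)
open import Data.Nat.DivMod using (_mod_)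
open import Data.Nat.Properties hiding (_≟_; _<?_; suc-injective)
open import Data.Nat.Solver using (module +-*-Solver)
open import Data.Product using (∃; ∃₂; _×_; _,_; proj₁; proj₂; uncurry)
open import Data.Sum using (_⊎_; inj₁; inj₂; [_,_]′)
open import Data.Unit using (tt)
open import Data.Vec using (Vec; []; _∷_; here; there; lookup) renaming (map to mapᵛ)
open import Data.Vec.Functional using (Vector; updateAt)
open import Data.Vec.Functional.Properties using (updateAt-updates; updateAt-minimal)
open import Data.Vec.Membership.Propositional using () renaming (_∈_ to _∈ᵛ_)
open import Data.Vec.Membership.Propositional.Properties using (∈-map⁺; ∈-lookup)
open import Data.Vec.Properties using (lookup-map)
open import Data.Vec.Relation.Unary.All.Properties using (lookup⁻)
open import Data.Vec.Relation.Unary.All using () renaming ([] to []ᵃ)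
open import Data.Vec.Relation.Unary.AllPairs using () renaming ([] to []ᵘ; _∷_ to _∷ᵘ_)
import Data.Vec.Relation.Unary.Any as VecAny
open import Data.Vec.Relation.Unary.Unique.Propositional using (Unique)
open import Data.Vec.Relation.Unary.Unique.Propositional.Properties using (lookup-injective)
open import Function using (_∘_; const; id)
open import Function.Definitions using (Injective)
open import Level using (0ℓ)
open import Relation.Binary.Construct.Closure.ReflexiveTransitive using (Star; ε; _◅_; _◅◅_; gmap)
open import Relation.Binary.Definitions using (DecidableEquality)
open import Relation.Binary.PropositionalEquality
open import Relation.Nullary using (¬_; Dec; yes; no; does; contradiction; map′; _×-dec_; _→-dec_; _⊎-dec_; from-yes; from-no; toWitness; fromWitness; ¬¬-excluded-middle)
open import Relation.Nullary.Decidable using (⌊_⌋; dec-true; dec-false)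
open import Relation.Unary using (Pred; Decidable; _∪_)
open import Relation.Unary.Properties using (_∪?_)
open import Algebra.Properties.CommutativeMonoid.Sum +-0-commutativeMonoid using (sum; sum-cong-≗; sum-replicate-zero; sum-permute; ∑-distrib-+; ∑-comm)
open import Defs

open MixedGraph using (link)

private
  variable
    n m v w : ℕ

-- Links, palettes and homomorphisms

joined⇒≢ : ∀ (G : MixedGraph n m v) {x y} → T (joined (link G x y)) → x ≢ y
joined⇒≢ G {x} j refl = subst (T ∘ joined) (MixedGraph.loopless G x) j

reverse-involutive : ∀ (l : Link n m) → reverse (reverse l) ≡ l
reverse-involutive none        = refl
reverse-involutive (arcTo _)   = refl
reverse-involutive (arcFrom _) = refl
reverse-involutive (edge _)    = refl

-- The 2n + m = 3 ways in which an ordered pair of adjacent vertices can be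
-- joined; the last one is an edge type.
record Palette (n m : ℕ) : Set where
  field
    τ           : Fin 3 → Link n m
    τ-joined    : ∀ a → T (joined (τ a))
    τ-injective : ∀ {a b} → τ a ≡ τ b → a ≡ b
    τ-onto      : ∀ l → T (joined l) → ∃ λ a → τ a ≡ l
    τ-edge      : reverse (τ 2F) ≡ τ 2F

palette₀₃ : Palette 0 3
palette₀₃ = record
  { τ           = edge
  ; τ-joined    = λ _ → tt
  ; τ-injective = λ { refl → refl }
  ; τ-onto      = λ { (edge j) _ → j , refl }
  ; τ-edge      = refl
  }

palette₁₁ : Palette 1 1
palette₁₁ = record
  { τ           = τ
  ; τ-joined    = λ { zero → tt ; (suc zero) → tt ; (suc (suc zero)) → tt }
  ; τ-injective = λ {a} {b} eq → trans (sym (index-τ a)) (trans (cong index eq) (index-τ b))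
  ; τ-onto      = λ { (arcTo zero) _   → zero , refl
                    ; (arcFrom zero) _ → suc zero , refl
                    ; (edge zero) _    → suc (suc zero) , refl }
  ; τ-edge      = refl
  }
  where
  τ : Fin 3 → Link 1 1
  τ zero             = arcTo zero
  τ (suc zero)       = arcFrom zero
  τ (suc (suc zero)) = edge zero

  index : Link 1 1 → Fin 3
  index (arcFrom _) = suc zero
  index (edge _)    = suc (suc zero)
  index _           = zero

  index-τ : ∀ a → index (τ a) ≡ a
  index-τ zero             = refl
  index-τ (suc zero)       = refl
  index-τ (suc (suc zero)) = refl

module _ {G : MixedGraph n m v} {H : MixedGraph n m w} where

  ⟶-link : (f : G ⟶ H) → let open _⟶_ f in
           ∀ x y → T (joined (link G x y)) → link H (map x) (map y) ≡ link G x y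
  ⟶-link f x y j with link G x y in eq
  ... | arcTo i   = _⟶_.preservesArc f i x y eq
  ... | edge i    = _⟶_.preservesEdge f i x y eq
  -- A homomorphism is only required to preserve arcs read forwards, so the arc is read from `y` to
  -- `x` and its image is reversed.
  ... | arcFrom i =
    trans (MixedGraph.link-reverse H _ _)
          (cong reverse (_⟶_.preservesArc f i y x
            (trans (MixedGraph.link-reverse G x y) (cong reverse eq))))

  mk⟶ : (f : Fin v → Fin w) →
        (∀ x y → T (joined (link G x y)) → link H (f x) (f y) ≡ link G x y) → G ⟶ H
  mk⟶ f pres = record
    { map           = f
    ; preservesArc  = λ i x y eq → trans (pres x y (subst (T ∘ joined) (sym eq) tt)) eq
    ; preservesEdge = λ i x y eq → trans (pres x y (subst (T ∘ joined) (sym eq) tt)) eq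
    }

-- Extending colourings over a bag

members : (B : Subset v) → Vec (Fin v) ∣ B ∣
members []            = []
members (inside ∷ B)  = zero ∷ mapᵛ suc (members B)
members (outside ∷ B) = mapᵛ suc (members B)

∈-members⁺ : ∀ (B : Subset v) {x} → x ∈ B → x ∈ᵛ members B
∈-members⁺ (inside ∷ B)  here      = VecAny.here refl
∈-members⁺ (inside ∷ B)  (there p) = VecAny.there (∈-map⁺ suc (∈-members⁺ B p))
∈-members⁺ (outside ∷ B) (there p) = ∈-map⁺ suc (∈-members⁺ B p)

members-∈ : ∀ (B : Subset v) i → lookup (members B) i ∈ B
members-∈ (inside ∷ B)  zero    = here
members-∈ (inside ∷ B)  (suc i) =
  subst (_∈ (inside ∷ B)) (sym (lookup-map i suc (members B))) (there (members-∈ B i))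
members-∈ (outside ∷ B) i       =
  subst (_∈ (outside ∷ B)) (sym (lookup-map i suc (members B))) (there (members-∈ B i))

-- Bags with fewer than three members are listed with repetitions, so that only triples have to be
-- coloured.
cover₃ : ∀ (B : Subset v) → ∣ B ∣ ≤ 3 → ∀ {x₀} → x₀ ∈ B →
         ∃ λ (t : Fin 3 → Fin v) → (∀ i → t i ∈ B) × (∀ {x} → x ∈ B → ∃ λ i → x ≡ t i)
cover₃ {v} B B≤3 {x₀} x₀∈B =
  let t , t∈ , onto = pad B≤3 (members B) (members-∈ B)
  in  t , t∈ , onto ∘ ∈-members⁺ B
  where
  pad : ∀ {k} → k ≤ 3 → (xs : Vec (Fin v) k) → (∀ i → lookup xs i ∈ B) →
        ∃ λ (t : Fin 3 → Fin v) → (∀ i → t i ∈ B) × (∀ {x} → x ∈ᵛ xs → ∃ λ i → x ≡ t i)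
  pad _ [] _ = const x₀ , const x₀∈B , λ ()
  pad _ (a ∷ []) xs∈ = const a , const (xs∈ 0F) , λ { (VecAny.here p) → 0F , p }
  pad _ (a ∷ b ∷ []) xs∈ =
    (λ { 0F → a ; _ → b }) , (λ { 0F → xs∈ 0F ; 1F → xs∈ 1F ; 2F → xs∈ 1F }) ,
    λ { (VecAny.here p) → 0F , p ; (VecAny.there (VecAny.here p)) → 1F , p }
  pad _ (a ∷ b ∷ c ∷ []) xs∈ =
    (λ { 0F → a ; 1F → b ; 2F → c }) , (λ { 0F → xs∈ 0F ; 1F → xs∈ 1F ; 2F → xs∈ 2F }) ,
    λ { (VecAny.here p) → 0F , p ; (VecAny.there (VecAny.here p)) → 1F , p
      ; (VecAny.there (VecAny.there (VecAny.here p))) → 2F , p }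
  pad (s≤s (s≤s (s≤s ()))) (_ ∷ _ ∷ _ ∷ _ ∷ _) _

-- The fields serve a vertex with no, one or two already coloured companions in its bag.
record Extensible {h} (𝒫 : Palette n m) (H : MixedGraph n m h) : Set where
  open Palette 𝒫
  field
    root : Fin h
    ext₁ : ∀ p a → ∃ λ c → link H p c ≡ τ a
    ext₂ : ∀ p q → T (joined (link H p q)) → ∀ a b →
           ∃ λ c → link H p c ≡ τ a × link H q c ≡ τ b

module _ {h} {𝒫 : Palette n m} {H : MixedGraph n m h} (ext : Extensible 𝒫 H)
         (G : MixedGraph n m v) where
  open Palette 𝒫
  open Extensible ext

  -- The completion of G: a homomorphism is built so that it preserves
  -- filled on every bag, which keeps bags mapped to cliques of H.
  filled : Fin v → Fin v → Link n m
  filled x y = if joined (link G x y) then link G x y else τ 2F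

  filled-joined : ∀ x y → T (joined (filled x y))
  filled-joined x y with joined (link G x y) in eq
  ... | true  = subst T (sym eq) tt
  ... | false = τ-joined 2F

  filled-link : ∀ x y → T (joined (link G x y)) → filled x y ≡ link G x y
  filled-link x y j with joined (link G x y)
  ... | true = refl

  filled-reverse : ∀ x y → filled y x ≡ reverse (filled x y)
  filled-reverse x y with joined (link G x y) | joined (link G y x)
                        | SimpleGraph.symmetric (und G) x y
  ... | true  | true  | _ = MixedGraph.link-reverse G x y
  ... | false | false | _ = sym τ-edge
  ... | true  | false | s = contradiction s λ ()
  ... | false | true  | s = contradiction s λ ()

  Compatible : (Fin v → Fin h) → Fin v → Fin v → Set
  Compatible f x y = link H (f x) (f y) ≡ filled x y

  Compatible-sym : ∀ f {x y} → Compatible f x y → Compatible f y x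
  Compatible-sym f {x} {y} c =
    trans (MixedGraph.link-reverse H _ _) (trans (cong reverse c) (sym (filled-reverse x y)))

  Compatible-resp : ∀ (f f′ : Fin v → Fin h) {x y} → f′ x ≡ f x → f′ y ≡ f y →
                    Compatible f x y → Compatible f′ x y
  Compatible-resp _ _ p q c = trans (cong₂ (link H) p q) c

  -- `E` marks the vertices whose colour is fixed; the number of distinct ones among `p` and `q`
  -- decides which field of `Extensible` supplies `c`.
  colour : ∀ (f : Fin v → Fin h) {E : Pred (Fin v) 0ℓ} → Decidable E → ∀ p q →
           (E p → E q → p ≢ q → Compatible f p q) → ∀ z →
           ∃ λ c → (E p → link H (f p) c ≡ filled p z) × (E q → link H (f q) c ≡ filled q z)
  colour f E? p q comp z
    with τ-onto _ (filled-joined p z) | τ-onto _ (filled-joined q z) | E? p | E? q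
  ... | a , _ | b , _ | no ¬p | no ¬q = root , ⊥-elim ∘ ¬p , ⊥-elim ∘ ¬q
  ... | a , τa | b , _ | yes _ | no ¬q =
    let c , e = ext₁ (f p) a in c , (λ _ → trans e τa) , ⊥-elim ∘ ¬q
  ... | a , _ | b , τb | no ¬p | yes _ =
    let c , e = ext₁ (f q) b in c , ⊥-elim ∘ ¬p , (λ _ → trans e τb)
  ... | a , τa | b , τb | yes Ep | yes Eq with p ≟ q
  -- The two companions coincide when the triple listing the bag has a repetition.
  ...   | yes refl = let c , e = ext₁ (f p) a in c , (λ _ → trans e τa) , (λ _ → trans e τa)
  ...   | no p≢q   =
    let c , e , e′ = ext₂ (f p) (f q)
          (subst (T ∘ joined) (sym (comp Ep Eq p≢q)) (filled-joined p q)) a b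
    in  c , (λ _ → trans e τa) , (λ _ → trans e′ τb)

  module _ (t : Fin 3 → Fin v) where

    Fits : (Fin v → Fin h) → Pred (Fin v) 0ℓ → Set
    Fits f E = ∀ i j → E (t i) → E (t j) → t i ≢ t j → Compatible f (t i) (t j)

    -- A vertex `t i` outside `E` gets a colour that suits the other two entries of the triple;
    -- colours on `E` are kept, and values of `f` elsewhere carry no information.
    recolour₁ : ∀ f {E : Pred (Fin v) 0ℓ} → Decidable E → Fits f E → ∀ i j k → (∀ l → l ≡ i ⊎ l ≡ j ⊎ l ≡ k) →
                ∃ λ f′ → (∀ {x} → E x → f′ x ≡ f x) × Fits f′ (E ∪ (_≡ t i))
    recolour₁ f {E} E? fits i j k cover with E? (t i)
    ... | yes Eti = f , (λ _ → refl) , λ a b p q → fits a b (old p) (old q)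
      where
      old : ∀ {x} → E x ⊎ x ≡ t i → E x
      old (inj₁ e)    = e
      old (inj₂ refl) = Eti
    ... | no ¬Eti = f′ , keeps , fits′
      where
      new = colour f E? (t j) (t k) (fits j k) (t i)
      c   = proj₁ new
      f′  = updateAt f (t i) (const c)

      keeps : ∀ {x} → E x → f′ x ≡ f x
      keeps {x} Ex = updateAt-minimal x (t i) f λ { refl → ¬Eti Ex }

      toNew : ∀ a → E (t a) → Compatible f′ (t a) (t i)
      toNew a Ea = trans (cong₂ (link H) (keeps Ea) (updateAt-updates (t i) f)) (go (cover a))
        where
        go : a ≡ i ⊎ a ≡ j ⊎ a ≡ k → link H (f (t a)) c ≡ filled (t a) (t i)
        go (inj₁ refl)        = contradiction Ea ¬Eti
        go (inj₂ (inj₁ refl)) = proj₁ (proj₂ new) Ea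
        go (inj₂ (inj₂ refl)) = proj₂ (proj₂ new) Ea

      fits′ : Fits f′ (E ∪ (_≡ t i))
      fits′ a b (inj₁ Ea) (inj₁ Eb) ne = Compatible-resp f f′ (keeps Ea) (keeps Eb) (fits a b Ea Eb ne)
      fits′ a b (inj₁ Ea) (inj₂ tb≡ti) _ = subst (Compatible f′ (t a)) (sym tb≡ti) (toNew a Ea)
      fits′ a b (inj₂ ta≡ti) (inj₁ Eb) _ =
        Compatible-sym f′ (subst (Compatible f′ (t b)) (sym ta≡ti) (toNew b Eb))
      fits′ a b (inj₂ p) (inj₂ q) ne = contradiction (trans p (sym q)) ne

  recolour : ∀ (B : Subset v) → ∣ B ∣ ≤ 3 → ∀ f {E : Pred (Fin v) 0ℓ} → Decidable E →
             (∀ x y → x ∈ B → y ∈ B → E x → E y → x ≢ y → Compatible f x y) →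
             ∃ λ f′ → (∀ {x} → E x → f′ x ≡ f x) ×
                      (∀ x y → x ∈ B → y ∈ B → x ≢ y → Compatible f′ x y)
  recolour B B≤3 f {E} E? comp with nonempty? B
  ... | no  empty     = f , (λ _ → refl) , λ x _ x∈B → contradiction (x , x∈B) empty
  ... | yes (_ , x₀∈B) =
    f₃ , (λ e → trans (keep₃ (inj₁ (inj₁ e))) (trans (keep₂ (inj₁ e)) (keep₁ e))) , comp′
    where
    cov  = cover₃ B B≤3 x₀∈B
    t    = proj₁ cov
    t∈B  = proj₁ (proj₂ cov)
    onto = proj₂ (proj₂ cov)

    step₁ = recolour₁ t f E? (λ i j → comp _ _ (t∈B i) (t∈B j)) 0F 1F 2F
              λ { 0F → inj₁ refl ; 1F → inj₂ (inj₁ refl) ; 2F → inj₂ (inj₂ refl) }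
    E₁? = E? ∪? (_≟ t 0F)
    keep₁ = proj₁ (proj₂ step₁)
    step₂ = recolour₁ t (proj₁ step₁) E₁? (proj₂ (proj₂ step₁)) 1F 0F 2F
              λ { 0F → inj₂ (inj₁ refl) ; 1F → inj₁ refl ; 2F → inj₂ (inj₂ refl) }
    E₂? = E₁? ∪? (_≟ t 1F)
    keep₂ = proj₁ (proj₂ step₂)
    step₃ = recolour₁ t (proj₁ step₂) E₂? (proj₂ (proj₂ step₂)) 2F 0F 1F
              λ { 0F → inj₂ (inj₁ refl) ; 1F → inj₂ (inj₂ refl) ; 2F → inj₁ refl }
    keep₃ = proj₁ (proj₂ step₃)
    f₃ = proj₁ step₃

    done : ∀ i → (((E ∪ (_≡ t 0F)) ∪ (_≡ t 1F)) ∪ (_≡ t 2F)) (t i)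
    done 0F = inj₁ (inj₁ (inj₂ refl))
    done 1F = inj₁ (inj₂ refl)
    done 2F = inj₂ refl

    comp′ : ∀ x y → x ∈ B → y ∈ B → x ≢ y → Compatible f₃ x y
    comp′ x y x∈B y∈B ne with onto x∈B | onto y∈B
    ... | i , refl | j , refl = proj₂ (proj₂ step₃) i j (done i) (done j) ne

-- Walking through a tree decomposition

module _ {A : Set} (R : A → A → Set) where

  -- Indexing by the vector of vertices allows `Unique` to express simplicity, and `lookup` to give
  -- the vertex function of a `Cycle`.
  data Path : (k : ℕ) → A → A → Vec A (suc k) → Set where
    [_] : ∀ x → Path 0 x x (x ∷ [])
    _∷_ : ∀ {k x y z ys} → R x y → Path k y z ys → Path (suc k) x z (x ∷ ys)

module _ {A : Set} {R : A → A → Set} where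

  path-first : ∀ {k x z} {xs : Vec A (suc k)} → Path R k x z xs → lookup xs zero ≡ x
  path-first [ _ ]   = refl
  path-first (_ ∷ _) = refl

  path-last : ∀ {k x z} {xs : Vec A (suc k)} → Path R k x z xs → lookup xs (fromℕ k) ≡ z
  path-last [ _ ]   = refl
  path-last (_ ∷ p) = path-last p

  path-step : ∀ {k x z} {xs : Vec A (suc k)} → Path R k x z xs →
              ∀ i → R (lookup xs (inject₁ i)) (lookup xs (suc i))
  path-step (r ∷ p) zero    = subst (R _) (sym (path-first p)) r
  path-step (_ ∷ p) (suc i) = path-step p i

  SimplePath : A → A → Set
  SimplePath x z = ∃₂ λ k xs → Path R k x z xs × Unique xs

  path-suffix : ∀ {k x y z} {ys : Vec A (suc k)} → Path R k y z ys → Unique ys →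
                x ∈ᵛ ys → SimplePath x z
  path-suffix p       u        (VecAny.here refl) with p
  ... | [ _ ]  = _ , _ , p , u
  ... | _ ∷ _  = _ , _ , p , u
  path-suffix (_ ∷ p) (_ ∷ᵘ u) (VecAny.there x∈)  = path-suffix p u x∈

module _ {R : Fin v → Fin v → Set} where

  -- If the new first vertex already occurs on the path found for the rest, the path is cut back to
  -- start at that occurrence.
  loop-erase : ∀ {x z} → Star R x z → SimplePath {R = R} x z
  loop-erase ε = _ , _ , [ _ ] , ([]ᵃ ∷ᵘ []ᵘ)
  loop-erase {x} (r ◅ rs) with loop-erase rs
  ... | k , ys , p , u with VecAny.any? (x ≟_) ys
  ...   | yes x∈ys = path-suffix p u x∈ys
  ...   | no  x∉ys = _ , _ , r ∷ p , lookup⁻ (λ i → λ { refl → x∉ys (∈-lookup i ys) }) ∷ᵘ u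

module _ (S : SimpleGraph v) where
  open SimpleGraph S

  Adj-sym : ∀ {x y} → Adj x y → Adj y x
  Adj-sym {x} {y} = subst T (symmetric x y)

  -- Excluding the direction from b to a suffices, as a simple path from b
  -- does not return to b.
  Avoiding : Fin v → Fin v → Fin v → Fin v → Set
  Avoiding a b i j = Adj i j × ¬ (i ≡ b × j ≡ a)

  -- After loop erasure, length 0 would make `ab` a loop and length 1 would be the excluded step, so
  -- at least three vertices remain and `ab` closes the cycle.
  detour⇒cycle : ∀ {a b} → Adj a b → Star (Avoiding a b) b a → Cycle S
  detour⇒cycle {a} {b} ab walk with loop-erase walk
  ... | _ , _ , [ _ ] , _ = contradiction (subst T (loopless a) ab) λ ()
  ... | _ , _ , (_ , ¬ba) ∷ [ _ ] , _ = contradiction (refl , refl) ¬ba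
  ... | suc (suc k) , xs , p@(_ ∷ _ ∷ _) , u = record
    { length-3 = k
    ; vertex   = lookup xs
    ; distinct = lookup-injective u _ _
    ; step     = proj₁ ∘ path-step p
    ; closing  = subst₂ Adj (sym (path-last p)) refl ab
    }

module _ {h} {𝒫 : Palette n m} {H : MixedGraph n m h} (ext : Extensible 𝒫 H)
         (G : MixedGraph n m v) {S : SimpleGraph v}
         (D : TreeDecomposition S) (width : TreeDecomposition.WidthAtMost D 2) where
  open TreeDecomposition D
  open SimpleGraph tree using (Adj)
  open IsTree isTree
  open DecMembership (_≟_ {nodes}) using () renaming (_∈?_ to _∈ˡ?_)

  Within : List (Fin nodes) → Fin nodes → Fin nodes → Set
  Within U i j = Adj i j × i ∈ˡ U × j ∈ˡ U

  Visited : List (Fin nodes) → Pred (Fin v) 0ℓ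
  Visited U x = ∃ λ k → k ∈ˡ U × x ∈ bag k

  visited? : ∀ U → Decidable (Visited U)
  visited? U x = map′ find (λ (_ , k∈ , x∈) → lose k∈ x∈) (ListAny.any? (λ k → x ∈? bag k) U)

  -- The visited nodes are kept connected by `linked`, because a second contact with `U` can then be
  -- completed to a cycle.
  record Partial (U : List (Fin nodes)) : Set where
    field
      colouring : Fin v → Fin h
      linked    : ∀ {i j} → i ∈ˡ U → j ∈ˡ U → Star (Within U) i j
      good      : ∀ {k} → k ∈ˡ U → ∀ x y → x ∈ bag k → y ∈ bag k → x ≢ y →
                  Compatible ext G colouring x y

  -- Follow the x-walk from the new node b until it first meets U; meeting
  -- U anywhere but at a would close a cycle through the edge {a , b}.
  visited-in-parent : ∀ {U} → Partial U → ∀ {a b} → a ∈ˡ U → ¬ b ∈ˡ U → Adj a b →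
                      ∀ {x} → x ∈ bag b → Visited U x → x ∈ bag a
  visited-in-parent {U} part {a} {b} a∈U b∉U ab {x} x∈b (k , k∈U , x∈k) =
    enter ε b∉U (coherent x b k x∈b x∈k)
    where
    open Partial part
    enter : ∀ {i} → Star (Avoiding tree a b) b i → ¬ i ∈ˡ U → Star (AdjAt x) i k → x ∈ bag a
    enter _    i∉U ε = contradiction k∈U i∉U
    enter {i} past i∉U (_◅_ {j = j} (ij , _ , x∈j) rest) with j ≟ a
    ... | yes refl = x∈j
    ... | no j≢a with j ∈ˡ? U
    ...   | no  j∉U = enter (past ◅◅ ((ij , j≢a ∘ proj₂) ◅ ε)) j∉U rest
    ...   | yes j∈U = contradiction (detour⇒cycle tree ab
              (past ◅◅ ((ij , j≢a ∘ proj₂) ◅ gmap id avoids (linked j∈U a∈U)))) acyclic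
      where
      -- A step inside `U` cannot start at `b`, which is not in `U`.
      avoids : ∀ {i j} → Within U i j → Avoiding tree a b i j
      avoids (ij , i∈U , _) = ij , λ { (refl , _) → b∉U i∈U }

  -- By `visited-in-parent`, the already coloured members of the bag of `b` all lie in the bag of
  -- `a`, where they are known to be compatible; `recolour` then extends the colouring.
  visit : ∀ {U a b} → Partial U → a ∈ˡ U → ¬ b ∈ˡ U → Adj a b → Partial (b ∷ U)
  visit {U} {a} {b} part a∈U b∉U ab = record
    { colouring = f′ ; linked = linked′ ; good = good′ }
    where
    open Partial part
    new   = recolour ext G (bag b) (width b) colouring (visited? U)
              λ x y x∈b y∈b x∈U y∈U → good a∈U x y
                (visited-in-parent part a∈U b∉U ab x∈b x∈U)
                (visited-in-parent part a∈U b∉U ab y∈b y∈U)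
    f′    = proj₁ new
    keeps = proj₁ (proj₂ new)

    widen : ∀ {i j} → Star (Within U) i j → Star (Within (b ∷ U)) i j
    widen = gmap id λ (ij , i∈ , j∈) → ij , there i∈ , there j∈

    linked′ : ∀ {i j} → i ∈ˡ b ∷ U → j ∈ˡ b ∷ U → Star (Within (b ∷ U)) i j
    linked′ (here refl) (here refl) = ε
    linked′ (here refl) (there j∈)  =
      (Adj-sym tree ab , here refl , there a∈U) ◅ widen (linked a∈U j∈)
    linked′ (there i∈)  (here refl) =
      widen (linked i∈ a∈U) ◅◅ ((ab , there a∈U , here refl) ◅ ε)
    linked′ (there i∈)  (there j∈)  = widen (linked i∈ j∈)

    good′ : ∀ {k} → k ∈ˡ b ∷ U → ∀ x y → x ∈ bag k → y ∈ bag k → x ≢ y → Compatible ext G f′ x y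
    good′ (here refl) x y x∈ y∈ ne = proj₂ (proj₂ new) x y x∈ y∈ ne
    good′ (there k∈)  x y x∈ y∈ ne =
      Compatible-resp ext G colouring f′ (keeps (_ , k∈ , x∈)) (keeps (_ , k∈ , y∈))
        (good k∈ x y x∈ y∈ ne)

  Extends : List (Fin nodes) → List (Fin nodes) → Set
  Extends U U′ = ∀ {i} → i ∈ˡ U → i ∈ˡ U′

  visit-along : ∀ {a c} → Star Adj a c → ∀ {U} → Partial U → a ∈ˡ U →
                ∃ λ U′ → Partial U′ × Extends U U′ × c ∈ˡ U′
  visit-along ε part a∈ = _ , part , (λ i∈ → i∈) , a∈
  visit-along (_◅_ {j = b} ab bc) {U} part a∈ with b ∈ˡ? U
  ... | yes b∈ = visit-along bc part b∈
  ... | no  b∉ =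
    let U′ , part′ , ext′ , c∈ = visit-along bc (visit part a∈ b∉ ab) (here refl)
    in  U′ , part′ , ext′ ∘ there , c∈

  visit-all : ∀ {a U} → Partial U → a ∈ˡ U → ∀ todo →
              ∃ λ U′ → Partial U′ × Extends U U′ × (∀ {c} → c ∈ˡ todo → c ∈ˡ U′)
  visit-all part a∈ [] = _ , part , (λ i∈ → i∈) , λ ()
  visit-all part a∈ (c ∷ todo) =
    let U₁ , part₁ , ext₁ , c∈   = visit-along (connected _ c) part a∈
        U₂ , part₂ , ext₂ , all∈ = visit-all part₁ (ext₁ a∈) todo
    in  U₂ , part₂ , ext₂ ∘ ext₁ , λ { (here refl) → ext₂ c∈ ; (there c′∈) → all∈ c′∈ }

  start : ∀ a → Partial (a ∷ [])
  start a = record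
    { colouring = proj₁ new
    ; linked    = λ { (here refl) (here refl) → ε }
    ; good      = λ { (here refl) → proj₂ (proj₂ new) }
    }
    where
    -- The empty predicate says that nothing is coloured yet; the constant colouring is a mere
    -- default.
    new = recolour ext G (bag a) (width a) (const (Extensible.root ext)) {E = λ _ → ⊥}
            (λ _ → no λ ()) λ _ _ _ _ ()

  decomposition-colouring :
    ∃ λ f → ∀ k x y → x ∈ bag k → y ∈ bag k → x ≢ y → Compatible ext G f x y
  decomposition-colouring =
    let _ , part , _ , all∈ = visit-all (start a) (here refl) (allFin nodes)
    in  Partial.colouring part , λ k → Partial.good part (all∈ (∈-allFin k))
    where
    a : Fin nodes
    a = some nodes nonEmpty
      where
      some : ∀ k → NonZero k → Fin k
      some (suc _) _ = zero

-- Joined vertices share a bag, hence are compatible, and on joined pairs `filled` agrees with the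
-- link of `G`.
partial2tree-⟶ : ∀ {h} {𝒫 : Palette n m} {H : MixedGraph n m h} → Extensible 𝒫 H →
                 ∀ (G : MixedGraph n m v) {S} → und G ≐ S → Partial2Tree S → G ⟶ H
partial2tree-⟶ {H = H} ext G {S} G≐S (D , width) = mk⟶ f preserves
  where
  col = decomposition-colouring ext G D width
  f   = proj₁ col

  preserves : ∀ x y → T (joined (link G x y)) → link H (f x) (f y) ≡ link G x y
  preserves x y j =
    let k , x∈k , y∈k = TreeDecomposition.edgeCovered D x y (subst T (G≐S x y) j)
    in  trans (proj₂ col k x y x∈k y∈k (joined⇒≢ G j)) (filled-link ext G x y j)

-- Stacking apices on edges

∣p∪q∣≤∣p∣+∣q∣ : ∀ (p q : Subset v) → ∣ p ∪ˢ q ∣ ≤ ∣ p ∣ + ∣ q ∣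
∣p∪q∣≤∣p∣+∣q∣ []            []            = z≤n
∣p∪q∣≤∣p∣+∣q∣ (inside ∷ p)  (inside ∷ q)  =
  s≤s (≤-trans (m≤n⇒m≤1+n (∣p∪q∣≤∣p∣+∣q∣ p q)) (≤-reflexive (sym (+-suc _ _))))
∣p∪q∣≤∣p∣+∣q∣ (inside ∷ p)  (outside ∷ q) = s≤s (∣p∪q∣≤∣p∣+∣q∣ p q)
∣p∪q∣≤∣p∣+∣q∣ (outside ∷ p) (inside ∷ q)  =
  ≤-trans (s≤s (∣p∪q∣≤∣p∣+∣q∣ p q)) (≤-reflexive (sym (+-suc _ _)))
∣p∪q∣≤∣p∣+∣q∣ (outside ∷ p) (outside ∷ q) = ∣p∪q∣≤∣p∣+∣q∣ p q

-- Used to see that a leaf lies on no cycle. The first and last positions need `closing`; all others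
-- have a predecessor and a successor.
cycle-neighbours : {S : SimpleGraph v} (C : Cycle S) → let open Cycle C; open SimpleGraph S in
                   ∀ i → ∃₂ λ j k → vertex j ≢ vertex k × Adj (vertex i) (vertex j) × Adj (vertex i) (vertex k)
cycle-neighbours {S = S} C = λ where
    zero    → suc zero , fromℕ _ , ne (λ ()) , step zero , Adj-sym S closing
    (suc i) → inner i
  where
  open Cycle C
  open SimpleGraph S

  ne : ∀ {i j} → i ≢ j → vertex i ≢ vertex j
  ne i≢j = i≢j ∘ distinct

  last? : ∀ k (i : Fin (suc k)) → i ≡ fromℕ k ⊎ ∃ λ j → i ≡ inject₁ j
  last? zero    zero    = inj₁ refl
  last? (suc k) zero    = inj₂ (zero , refl)
  last? (suc k) (suc i) with last? k i
  ... | inj₁ refl       = inj₁ refl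
  ... | inj₂ (j , refl) = inj₂ (suc j , refl)

  inject₁≢suc-suc : ∀ {k} (j : Fin k) → inject₁ (inject₁ j) ≢ suc (suc j)
  inject₁≢suc-suc zero    ()
  inject₁≢suc-suc (suc j) = inject₁≢suc-suc j ∘ suc-injective

  inner : ∀ i → ∃₂ λ j k → vertex j ≢ vertex k × Adj (vertex (suc i)) (vertex j) × Adj (vertex (suc i)) (vertex k)
  inner i with last? _ i
  ... | inj₁ refl       =
    inject₁ (fromℕ _) , zero , ne (λ ()) , Adj-sym S (step (fromℕ _)) , closing
  ... | inj₂ (j , refl) =
    inject₁ (inject₁ j) , suc (suc j) , ne (inject₁≢suc-suc j) ,
    Adj-sym S (step (inject₁ j)) , step (suc j)

module _ (S : SimpleGraph v) (a : Fin v) where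
  open SimpleGraph S

  addLeaf : SimpleGraph (suc v)
  addLeaf = record
    { adj       = adj′
    ; loopless  = λ { zero → refl ; (suc x) → loopless x }
    ; symmetric = λ { zero zero → refl ; zero (suc _) → refl ; (suc _) zero → refl
                    ; (suc x) (suc y) → symmetric x y }
    }
    where
    adj′ : Fin (suc v) → Fin (suc v) → Bool
    adj′ zero    zero    = false
    adj′ zero    (suc y) = ⌊ y ≟ a ⌋
    adj′ (suc x) zero    = ⌊ x ≟ a ⌋
    adj′ (suc x) (suc y) = adj x y

  private module L = SimpleGraph addLeaf

  leaf-edge : L.Adj zero (suc a)
  leaf-edge = fromWitness refl

  leaf-neighbour : ∀ {x} → L.Adj zero x → x ≡ suc a
  leaf-neighbour {suc x} e = cong suc (toWitness e)

  -- The leaf has a single neighbour, so a cycle must avoid it and is then a cycle of `S`.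
  addLeaf-isTree : IsTree S → IsTree addLeaf
  addLeaf-isTree S-tree = record
    { nonEmpty = _ ; connected = connected′ ; acyclic = acyclic′ }
    where
    open IsTree S-tree

    lift : ∀ {x y} → Star Adj x y → Star L.Adj (suc x) (suc y)
    lift = gmap suc id

    connected′ : ∀ x y → Star L.Adj x y
    connected′ zero    zero    = ε
    connected′ zero    (suc y) = leaf-edge ◅ lift (connected a y)
    connected′ (suc x) zero    = lift (connected x a) ◅◅ (leaf-edge ◅ ε)
    connected′ (suc x) (suc y) = lift (connected x y)

    acyclic′ : ¬ Cycle addLeaf
    acyclic′ C with any? (λ i → Cycle.vertex C i ≟ zero)
    ... | yes (i , i≡leaf) =
      let j , k , j≢k , ij , ik = cycle-neighbours C i
          toLeaf : ∀ {j} → L.Adj (Cycle.vertex C i) j → j ≡ suc a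
          toLeaf {j} e = leaf-neighbour (subst (λ i → L.Adj i j) i≡leaf e)
      in  j≢k (trans (toLeaf ij) (sym (toLeaf ik)))
    ... | no avoids = acyclic record
      { length-3 = length-3
      ; vertex   = old
      ; distinct = λ {i} {j} eq → distinct (trans (sym (suc-old i)) (trans (cong suc eq) (suc-old j)))
      ; step     = λ i → subst₂ L.Adj (sym (suc-old _)) (sym (suc-old _)) (step i)
      ; closing  = subst₂ L.Adj (sym (suc-old _)) (sym (suc-old _)) closing
      }
      where
      open Cycle C

      pred′ : ∀ i → ∃ λ x → suc x ≡ vertex i
      pred′ i with vertex i in eq
      ... | zero  = contradiction (i , eq) avoids
      ... | suc x = x , refl

      old : Fin (3 + length-3) → Fin v
      old i = proj₁ (pred′ i)

      suc-old : ∀ i → suc (old i) ≡ vertex i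
      suc-old i = proj₂ (pred′ i)

module _ (𝒫 : Palette n m) where
  open Palette 𝒫

  module _ (G : MixedGraph n m v) (x y : Fin v) (a b : Fin 3) where

    toNew : Fin v → Link n m
    toNew u = if does (u ≟ x) then τ a else if does (u ≟ y) then τ b else none

    addVertex : MixedGraph n m (suc v)
    addVertex = record
      { link         = link′
      ; loopless     = λ { zero → refl ; (suc u) → MixedGraph.loopless G u }
      ; link-reverse = λ { zero zero → refl
                         ; zero (suc u) → sym (reverse-involutive (toNew u))
                         ; (suc u) zero → refl
                         ; (suc u) (suc u′) → MixedGraph.link-reverse G u u′ }
      }
      where
      link′ : Fin (suc v) → Fin (suc v) → Link n m
      link′ zero    zero     = none
      link′ zero    (suc u)  = reverse (toNew u)
      link′ (suc u) zero     = toNew u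
      link′ (suc u) (suc u′) = link G u u′

    addVertex-x : link addVertex (suc x) zero ≡ τ a
    addVertex-x with x ≟ x
    ... | yes _  = refl
    ... | no x≢x = contradiction refl x≢x

    addVertex-y : x ≢ y → link addVertex (suc y) zero ≡ τ b
    addVertex-y x≢y with y ≟ x | y ≟ y
    ... | yes y≡x | _       = contradiction (sym y≡x) x≢y
    ... | no _    | yes _   = refl
    ... | no _    | no y≢y  = contradiction refl y≢y

    -- The bag made of the new vertex, `x` and `y` is hung as a leaf on a node `i₀` whose bag
    -- contains both ends of the edge `xy`.
    addVertex-partial2tree : T (joined (link G x y)) → Partial2Tree (und G) →
                             Partial2Tree (und addVertex)
    addVertex-partial2tree xy (D , width) = record
      { nodes         = suc nodes
      ; tree          = addLeaf tree i₀
      ; isTree        = addLeaf-isTree tree i₀ isTree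
      ; bag           = bag′
      ; vertexCovered = λ { zero → zero , here
                          ; (suc u) → let i , u∈ = vertexCovered u in suc i , there u∈ }
      ; edgeCovered   = λ { zero zero ()
                          ; zero (suc u) e →
                              zero , here , there (ends u (subst T (joined-reverse (toNew u)) e))
                          ; (suc u) zero e → zero , there (ends u e) , here
                          ; (suc u) (suc u′) e →
                              let i , u∈ , u′∈ = edgeCovered u u′ e
                              in  suc i , there u∈ , there u′∈ }
      ; coherent      = coherent′
      } , λ { zero → s≤s (≤-trans (∣p∪q∣≤∣p∣+∣q∣ ⁅ x ⁆ ⁅ y ⁆)
                           (≤-reflexive (cong₂ _+_ (∣⁅x⁆∣≡1 x) (∣⁅x⁆∣≡1 y))))
            ; (suc i) → width i }
      where
      open TreeDecomposition D
      i₀ = proj₁ (edgeCovered x y xy)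

      bag′ : Fin (suc nodes) → Subset (suc v)
      bag′ zero    = inside ∷ (⁅ x ⁆ ∪ˢ ⁅ y ⁆)
      bag′ (suc i) = outside ∷ bag i

      ends : ∀ u → T (joined (toNew u)) → u ∈ ⁅ x ⁆ ∪ˢ ⁅ y ⁆
      ends u e with u ≟ x | u ≟ y
      ... | yes refl | _        = x∈p∪q⁺ (inj₁ (x∈⁅x⁆ u))
      ... | no _     | yes refl = x∈p∪q⁺ (inj₂ (x∈⁅x⁆ u))

      anchored : ∀ {u} → u ∈ ⁅ x ⁆ ∪ˢ ⁅ y ⁆ → u ∈ bag i₀
      anchored u∈ with x∈p∪q⁻ ⁅ x ⁆ ⁅ y ⁆ u∈
      ... | inj₁ u∈x rewrite x∈⁅y⁆⇒x≡y x u∈x = proj₁ (proj₂ (edgeCovered x y xy))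
      ... | inj₂ u∈y rewrite x∈⁅y⁆⇒x≡y y u∈y = proj₂ (proj₂ (edgeCovered x y xy))

      AdjAt′ : Fin (suc v) → Fin (suc nodes) → Fin (suc nodes) → Set
      AdjAt′ u i j = SimpleGraph.Adj (addLeaf tree i₀) i j × u ∈ bag′ i × u ∈ bag′ j

      lift : ∀ {u i j} → Star (AdjAt u) i j → Star (AdjAt′ (suc u)) (suc i) (suc j)
      lift = gmap suc λ (e , ∈i , ∈j) → e , there ∈i , there ∈j

      coherent′ : ∀ u i j → u ∈ bag′ i → u ∈ bag′ j → Star (AdjAt′ u) i j
      coherent′ u       zero    zero    _          _          = ε
      coherent′ (suc u) zero    (suc j) (there u∈) (there u∈j) =
        (leaf-edge tree i₀ , there u∈ , there (anchored u∈)) ◅ lift (coherent u i₀ j (anchored u∈) u∈j)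
      coherent′ (suc u) (suc i) zero    (there u∈i) (there u∈) =
        lift (coherent u i i₀ u∈i (anchored u∈)) ◅◅
        ((leaf-edge tree i₀ , there (anchored u∈) , there u∈) ◅ ε)
      coherent′ (suc u) (suc i) (suc j) (there u∈i) (there u∈j) = lift (coherent u i j u∈i u∈j)

  -- Links are preserved exactly, `none` included, so a pair that is unjoined in `G` stays unjoined
  -- in the extension.
  record Extension (G : MixedGraph n m v) : Set where
    constructor extension
    field
      {order}  : ℕ
      graph    : MixedGraph n m order
      p2t      : Partial2Tree (und graph)
      ι        : Fin v → Fin order
      ι-link   : ∀ x y → link graph (ι x) (ι y) ≡ link G x y

  Item : ℕ → Set
  Item v = (Fin v × Fin v) × Fin 3 × Fin 3

  Apex : (G : MixedGraph n m v) → Item v → Set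
  Apex G ((x , y) , a , b) =
    T (joined (link G x y)) → ∃ λ w → link G x w ≡ τ a × link G y w ≡ τ b

  -- The items refer to a fixed vertex set, which `σ` places in the current graph; the list
  -- therefore stays the same while vertices are added.
  saturate : ∀ {u} (G : MixedGraph n m v) → Partial2Tree (und G) →
             (σ : Fin u → Fin v) (items : List (Item u)) →
             ∃ λ (E : Extension G) → let open Extension E in
             ∀ {x y a b} → ((x , y) , a , b) ∈ˡ items → Apex graph ((ι (σ x) , ι (σ y)) , a , b)
  saturate G p2t σ [] = extension G p2t id (λ _ _ → refl) , λ ()
  saturate G p2t σ (((x , y) , a , b) ∷ items) with T? (joined (link G (σ x) (σ y)))
  ... | no ¬xy =
    let E , apex = saturate G p2t σ items
    in  E , λ { (here refl) e → contradiction (subst (T ∘ joined) (Extension.ι-link E (σ x) (σ y)) e) ¬xy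
              ; (there p)     → apex p }
  ... | yes xy =
    let G′ = addVertex G (σ x) (σ y) a b
        extension G″ p2t″ ι ι-link , apex =
          saturate G′ (addVertex-partial2tree G (σ x) (σ y) a b xy p2t) (suc ∘ σ) items
    in  extension G″ p2t″ (ι ∘ suc) (λ u u′ → ι-link (suc u) (suc u′)) ,
        λ { (here refl) _ → ι zero ,
              trans (ι-link (suc (σ x)) zero) (addVertex-x G (σ x) (σ y) a b) ,
              trans (ι-link (suc (σ y)) zero) (addVertex-y G (σ x) (σ y) a b (joined⇒≢ G xy))
          ; (there p) → apex p }

  saturate-all : ∀ (G : MixedGraph n m v) → Partial2Tree (und G) →
                 ∃ λ (E : Extension G) → let open Extension E in
                 ∀ x y a b → Apex graph ((ι x , ι y) , a , b)
  saturate-all {v = v} G p2t =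
    let E , apex = saturate G p2t id (cartesianProduct (cartesianProduct (allFin v) (allFin v))
                                                    (cartesianProduct (allFin 3) (allFin 3)))
    in  E , λ x y a b → apex (∈-cartesianProduct⁺ (∈-cartesianProduct⁺ (∈-allFin x) (∈-allFin y))
                                                   (∈-cartesianProduct⁺ (∈-allFin a) (∈-allFin b)))

  module _ {k} (H : MixedGraph n m k) where

    -- The link p q is the image of an edge over which d more layers of
    -- apices can be stacked.
    data Deep : ℕ → Fin k → Fin k → Set where
      flat  : ∀ {p q} → T (joined (link H p q)) → Deep zero p q
      stack : ∀ {d p q} → T (joined (link H p q)) →
              (∀ a b → ∃ λ w → link H p w ≡ τ a × link H q w ≡ τ b × Deep d p w × Deep d q w) →
              Deep (suc d) p q

  module _ {k} {H : MixedGraph n m k} where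

    Deep-joined : ∀ {d p q} → Deep H d p q → T (joined (link H p q))
    Deep-joined (flat e)    = e
    Deep-joined (stack e _) = e

    Deep-apex : ∀ {d p q} → Deep H (suc d) p q → ∀ a b →
                ∃ λ w → link H p w ≡ τ a × link H q w ≡ τ b × Deep H d p w × Deep H d q w
    Deep-apex (stack _ apex) = apex

    Deep-pred : ∀ {d p q} → Deep H (suc d) p q → Deep H d p q
    Deep-pred {zero}  (stack e _)    = flat e
    Deep-pred {suc d} (stack e apex) = stack e λ a b →
      let w , pw , qw , Dpw , Dqw = apex a b
      in  w , pw , qw , Deep-pred Dpw , Deep-pred Dqw

    Deep-sym : ∀ {d p q} → Deep H d p q → Deep H d q p
    Deep-sym (flat e)       = flat (Adj-sym (und H) e)
    Deep-sym (stack e apex) = stack (Adj-sym (und H) e) λ a b →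
      let w , pw , qw , Dpw , Dqw = apex b a
      in  w , qw , pw , Dqw , Dpw

  -- One layer of apices is added first and the recursion is applied to the result, so the edges to
  -- the new apices also get depth `d`. The extension is chosen before the target `H`.
  deep-extension : ∀ d (G : MixedGraph n m v) → Partial2Tree (und G) →
                   ∃ λ (E : Extension G) → let open Extension E in
                   ∀ {k} (H : MixedGraph n m k) (f : graph ⟶ H) → let open _⟶_ f in
                   ∀ x y → T (joined (link G x y)) → Deep H d (map (ι x)) (map (ι y))
  deep-extension zero G p2t =
    extension G p2t id (λ _ _ → refl) ,
    λ H f x y xy → flat (subst (T ∘ joined) (sym (⟶-link f x y xy)) xy)
  deep-extension (suc d) G p2t =
    let extension G₁ p2t₁ ι₁ ι₁-link , apex = saturate-all G p2t
        extension G₂ p2t₂ ι₂ ι₂-link , deep = deep-extension d G₁ p2t₁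
    in  extension G₂ p2t₂ (ι₂ ∘ ι₁) (λ x y → trans (ι₂-link _ _) (ι₁-link x y)) ,
        λ H f x y xy →
          let image : ∀ {u u′} → T (joined (link G₁ u u′)) →
                      link H (_⟶_.map f (ι₂ u)) (_⟶_.map f (ι₂ u′)) ≡ link G₁ u u′
              image {u} {u′} e =
                trans (⟶-link f _ _ (subst (T ∘ joined) (sym (ι₂-link u u′)) e)) (ι₂-link u u′)
              type : ∀ {u u′ c} → link G₁ u u′ ≡ τ c → T (joined (link G₁ u u′))
              type {c = c} e = subst (T ∘ joined) (sym e) (τ-joined c)
              xy₁ = subst (T ∘ joined) (sym (ι₁-link x y)) xy
          in  stack (Deep-joined (deep H f _ _ xy₁)) λ a b →
              let w , xw , yw = apex x y a b xy₁
              in  _⟶_.map f (ι₂ w) , trans (image (type xw)) xw , trans (image (type yw)) yw ,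
                  deep H f _ _ (type xw) , deep H f _ _ (type yw)

  singleEdge : MixedGraph n m 2
  singleEdge = record
    { link         = link′
    ; loopless     = λ { 0F → refl ; 1F → refl }
    ; link-reverse = λ { 0F 0F → refl ; 1F 1F → refl ; 0F 1F → sym τ-edge ; 1F 0F → sym τ-edge }
    }
    where
    link′ : Fin 2 → Fin 2 → Link n m
    link′ 0F 1F = τ 2F
    link′ 1F 0F = τ 2F
    link′ _  _  = none

  singleEdge-partial2tree : Partial2Tree (und singleEdge)
  singleEdge-partial2tree = record
    { nodes         = 1
    ; tree          = record { adj = λ _ _ → false ; loopless = λ _ → refl ; symmetric = λ _ _ → refl }
    ; isTree        = record { nonEmpty = _ ; connected = λ { 0F 0F → ε } ; acyclic = Cycle.closing }
    ; bag           = λ _ → ⊤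
    ; vertexCovered = λ _ → 0F , ∈⊤
    ; edgeCovered   = λ _ _ _ → 0F , ∈⊤ , ∈⊤
    ; coherent      = λ { _ 0F 0F _ _ → ε }
    } , λ _ → s≤s (s≤s z≤n)

  deepGraph : ∀ d → ∃₂ λ v (G : MixedGraph n m v) → Partial2Tree (und G) ×
              ∀ {k} (H : MixedGraph n m k) → G ⟶ H → ∃₂ (Deep H d)
  deepGraph d =
    let extension G p2t ι _ , deep = deep-extension d singleEdge singleEdge-partial2tree
    in  _ , G , p2t , λ H f → _ , _ , deep H f 0F 1F (τ-joined 2F)

-- Targets of order at most 13

infix 4 _≟ᴸ_

_≟ᴸ_ : DecidableEquality (Link n m)
none      ≟ᴸ none      = yes refl
none      ≟ᴸ arcTo _   = no λ ()
none      ≟ᴸ arcFrom _ = no λ ()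
none      ≟ᴸ edge _    = no λ ()
arcTo _   ≟ᴸ none      = no λ ()
arcTo i   ≟ᴸ arcTo j   = map′ (cong arcTo) (λ { refl → refl }) (i ≟ j)
arcTo _   ≟ᴸ arcFrom _ = no λ ()
arcTo _   ≟ᴸ edge _    = no λ ()
arcFrom _ ≟ᴸ none      = no λ ()
arcFrom _ ≟ᴸ arcTo _   = no λ ()
arcFrom i ≟ᴸ arcFrom j = map′ (cong arcFrom) (λ { refl → refl }) (i ≟ j)
arcFrom _ ≟ᴸ edge _    = no λ ()
edge _    ≟ᴸ none      = no λ ()
edge _    ≟ᴸ arcTo _   = no λ ()
edge _    ≟ᴸ arcFrom _ = no λ ()
edge i    ≟ᴸ edge j    = map′ (cong edge) (λ { refl → refl }) (i ≟ j)

-- A missed value could be added to `f` as one more image, giving an injection from a set of size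
-- `suc v`.
injective⇒surjective : ∀ {k} {f : Fin v → Fin k} → Injective _≡_ _≡_ f → k ≤ v →
                       ∀ y → ∃ λ x → f x ≡ y
injective⇒surjective {v} {k} {f} inj k≤v y with any? (λ x → f x ≟ y)
... | yes hit  = hit
... | no  miss = contradiction (≤-trans (injective⇒≤ {f = f′} inj′) k≤v) (n≮n v)
  where
  f′ : Fin (suc v) → Fin k
  f′ zero    = y
  f′ (suc x) = f x

  inj′ : Injective _≡_ _≡_ f′
  inj′ {zero}  {zero}  _  = refl
  inj′ {zero}  {suc x} eq = contradiction (x , sym eq) miss
  inj′ {suc x} {zero}  eq = contradiction (x , eq) miss
  inj′ {suc _} {suc _} eq = cong suc (inj eq)

-- Sums over triples and their rotations

sum-single : (f : Vector ℕ v) → ∀ i → (∀ j → j ≢ i → f j ≡ 0) → sum f ≡ f i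
sum-single {suc v} f zero    0s =
  trans (cong (f zero +_) (trans (sum-cong-≗ (λ j → 0s (suc j) λ ())) (sum-replicate-zero v)))
        (+-identityʳ _)
sum-single {suc v} f (suc i) 0s =
  trans (cong (_+ sum (f ∘ suc)) (0s zero λ ()))
        (sum-single (f ∘ suc) i λ j j≢i → 0s (suc j) (j≢i ∘ suc-injective))

sum³ : (Fin v → Fin v → Fin v → ℕ) → ℕ
sum³ f = sum λ x → sum λ y → sum λ z → f x y z

sum³-cong : ∀ {f g : Fin v → Fin v → Fin v → ℕ} → (∀ x y z → f x y z ≡ g x y z) → sum³ f ≡ sum³ g
sum³-cong eq = sum-cong-≗ λ x → sum-cong-≗ λ y → sum-cong-≗ (eq x y)

sum³-+ : ∀ (f g : Fin v → Fin v → Fin v → ℕ) →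
         sum³ (λ x y z → f x y z + g x y z) ≡ sum³ f + sum³ g
sum³-+ f g = begin
  sum³ (λ x y z → f x y z + g x y z)
    ≡⟨ (sum-cong-≗ λ x → sum-cong-≗ λ y → ∑-distrib-+ (f x y) (g x y)) ⟩
  (sum λ x → sum λ y → sum (f x y) + sum (g x y))
    ≡⟨ (sum-cong-≗ λ x → ∑-distrib-+ (λ y → sum (f x y)) (λ y → sum (g x y))) ⟩
  (sum λ x → (sum λ y → sum (f x y)) + (sum λ y → sum (g x y)))
    ≡⟨ ∑-distrib-+ (λ x → sum λ y → sum (f x y)) (λ x → sum λ y → sum (g x y)) ⟩
  sum³ f + sum³ g ∎
  where open ≡-Reasoning

sum³-rotate : ∀ (f : Fin v → Fin v → Fin v → ℕ) → sum³ (λ x y z → f y z x) ≡ sum³ f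
sum³-rotate f = trans (∑-comm λ x y → sum λ z → f y z x) (sum-cong-≗ λ y → ∑-comm λ x z → f y z x)

-- Each triple counted by t is represented by the one of its three rotations
-- that first selects.
module _ (first : Fin v → Fin v → Fin v → ℕ)
         (t : Fin v → Fin v → Fin v → ℕ)
         (t-rotate : ∀ x y z → t y z x ≡ t x y z)
         (exactly-one : ∀ x y z → t x y z ≡ 0 ⊎ first x y z + first y z x + first z x y ≡ 1) where

  3∣sum³ : 3 ∣ sum³ t
  3∣sum³ = divides (sum³ s) (begin
    sum³ t                                            ≡⟨ sum³-cong split ⟩
    sum³ (λ x y z → s x y z + s y z x + s z x y)      ≡⟨ sum³-+ (λ x y z → s x y z + s y z x) (λ x y z → s z x y) ⟩
    sum³ (λ x y z → s x y z + s y z x) + sum³ (λ x y z → s z x y)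
      ≡⟨ cong₂ _+_ (sum³-+ s (λ x y z → s y z x)) (sym (sum³-rotate λ x y z → s z x y)) ⟩
    sum³ s + sum³ (λ x y z → s y z x) + sum³ s        ≡⟨ cong (λ r → sum³ s + r + sum³ s) (sum³-rotate s) ⟩
    sum³ s + sum³ s + sum³ s                          ≡⟨ solve 1 (λ r → r :+ r :+ r := r :* con 3) refl (sum³ s) ⟩
    sum³ s * 3                                        ∎)
    where
    open ≡-Reasoning
    open +-*-Solver

    s : Fin _ → Fin _ → Fin _ → ℕ
    s x y z = first x y z * t x y z

    split : ∀ x y z → t x y z ≡ s x y z + s y z x + s z x y
    split x y z rewrite t-rotate x y z | trans (t-rotate y z x) (t-rotate x y z) with exactly-one x y z
    ... | inj₁ t≡0 rewrite t≡0 | *-zeroʳ (first x y z) | *-zeroʳ (first y z x) | *-zeroʳ (first z x y) = refl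
    ... | inj₂ one = sym (begin
      first x y z * t x y z + first y z x * t x y z + first z x y * t x y z
        ≡⟨ solve 4 (λ a b c d → a :* d :+ b :* d :+ c :* d := (a :+ b :+ c) :* d) refl
             (first x y z) (first y z x) (first z x y) (t x y z) ⟩
      (first x y z + first y z x + first z x y) * t x y z ≡⟨ cong (_* t x y z) one ⟩
      1 * t x y z                                         ≡⟨ +-identityʳ _ ⟩
      t x y z                                             ∎)

-- The neighbourhood of a vertex on deep links

module _ (𝒫 : Palette n m) {k} (H : MixedGraph n m k) where
  open Palette 𝒫

  τ-link⇒≢ : ∀ {x y a} → link H x y ≡ τ a → x ≢ y
  τ-link⇒≢ {a = a} e = joined⇒≢ H (subst (T ∘ joined) (sym e) (τ-joined a))

  -- For each type `a`, the vertex `base a` and the three apices over the link from `x` to it are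
  -- four neighbours of `x` of type `a`. With `x` itself this makes 1 + 3 · 4 = 13 vertices.
  module Fan {d} (x : Fin k) (base : Fin 3 → Fin k)
             (base-link : ∀ a → link H x (base a) ≡ τ a)
             (base-deep : ∀ a → Deep 𝒫 H (suc d) x (base a)) where

    ν : Fin 3 → Fin 4 → Fin k
    ν a zero    = base a
    ν a (suc b) = proj₁ (Deep-apex 𝒫 (base-deep a) a b)

    ν-link : ∀ a i → link H x (ν a i) ≡ τ a
    ν-link a zero    = base-link a
    ν-link a (suc b) = proj₁ (proj₂ (Deep-apex 𝒫 (base-deep a) a b))

    ν-base : ∀ a b → link H (base a) (ν a (suc b)) ≡ τ b
    ν-base a b = proj₁ (proj₂ (proj₂ (Deep-apex 𝒫 (base-deep a) a b)))

    ν-deep : ∀ a i → Deep 𝒫 H d x (ν a i)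
    ν-deep a zero    = Deep-pred 𝒫 (base-deep a)
    ν-deep a (suc b) = proj₁ (proj₂ (proj₂ (proj₂ (Deep-apex 𝒫 (base-deep a) a b))))

    -- The link from `x` tells the types `a` apart. Within one type, the links from `base a` tell
    -- the apices apart, and having such a link distinguishes them from `base a`.
    ν-injective : ∀ p q → uncurry ν p ≡ uncurry ν q → p ≡ q
    ν-injective (a , i) (b , j) eq
      with refl ← τ-injective (trans (sym (ν-link a i)) (trans (cong (link H x) eq) (ν-link b j)))
      = cong (a ,_) (same i j eq)
      where
      same : ∀ i j → ν a i ≡ ν a j → i ≡ j
      same zero    zero     _  = refl
      same zero    (suc c)  eq = contradiction eq (τ-link⇒≢ (ν-base a c))
      same (suc c) zero     eq = contradiction (sym eq) (τ-link⇒≢ (ν-base a c))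
      same (suc c) (suc c′) eq =
        cong suc (τ-injective (trans (sym (ν-base a c)) (trans (cong (link H (base a)) eq) (ν-base a c′))))

    around : Fin 13 → Fin k
    around zero    = x
    around (suc i) = uncurry ν (remQuot 4 i)

    around-injective : Injective _≡_ _≡_ around
    around-injective {zero}  {zero}  _  = refl
    around-injective {zero}  {suc j} eq = contradiction eq (τ-link⇒≢ (uncurry ν-link (remQuot 4 j)))
    around-injective {suc i} {zero}  eq = contradiction (sym eq) (τ-link⇒≢ (uncurry ν-link (remQuot 4 i)))
    around-injective {suc i} {suc j} eq = cong suc (begin
      i                                 ≡⟨ combine-remQuot {3} 4 i ⟨
      uncurry combine (remQuot {3} 4 i) ≡⟨ cong (uncurry (combine {3} {4})) (ν-injective (remQuot {3} 4 i) (remQuot {3} 4 j) eq) ⟩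
      uncurry combine (remQuot {3} 4 j) ≡⟨ combine-remQuot {3} 4 j ⟩
      j                                 ∎)
      where open ≡-Reasoning

    13≤k : 13 ≤ k
    13≤k = injective⇒≤ around-injective

    module _ (k≤13 : k ≤ 13) where

      around-surjective : ∀ w → ∃ λ i → around i ≡ w
      around-surjective = injective⇒surjective around-injective k≤13

      neighbour : ∀ w → x ≢ w → ∃₂ λ a i → ν a i ≡ w
      neighbour w x≢w with around-surjective w
      ... | zero  , eq = contradiction eq x≢w
      ... | suc i , eq = proj₁ (remQuot {3} 4 i) , proj₂ (remQuot {3} 4 i) , eq

      around-permutation : Permutation 13 k
      around-permutation = permutation around (proj₁ ∘ around-surjective)
        (proj₂ ∘ around-surjective) (λ i → around-injective (proj₂ (around-surjective (around i))))

  module _ {d x y} (xy : Deep 𝒫 H (suc (suc d)) x y) where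

    apex-base : ∃ λ (base : Fin 3 → Fin k) →
                (∀ a → link H x (base a) ≡ τ a) × (∀ a → Deep 𝒫 H (suc d) x (base a))
    apex-base = (λ a → proj₁ (apex a)) , (λ a → proj₁ (proj₂ (apex a))) ,
                λ a → proj₁ (proj₂ (proj₂ (proj₂ (apex a))))
      -- The type `0F` prescribed towards `y` is an arbitrary choice.
      where apex = λ a → Deep-apex 𝒫 xy a 0F

    -- The fan at `x` exhausts the target. Two layers are spent, one on the bases and one on the
    -- apices over them.
    deep-everywhere : k ≤ 13 → ∀ w → x ≢ w → Deep 𝒫 H d x w
    deep-everywhere k≤13 w x≢w =
      let base , base-link , base-deep = apex-base
          open Fan x base base-link base-deep
          a , i , eq = neighbour k≤13 w x≢w
      in  subst (Deep 𝒫 H d x) eq (ν-deep a i)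

  -- Two layers lead from `x` to `u` and two more from `u` to `w`; if `u` is `x`, the surplus is
  -- dropped.
  deep-all : k ≤ 13 → ∀ {d x y} → Deep 𝒫 H (4 + d) x y → ∀ u w → u ≢ w → Deep 𝒫 H d u w
  deep-all k≤13 {d} {x} xy u w u≢w with x ≟ u
  ... | yes refl = Deep-pred 𝒫 (Deep-pred 𝒫 (deep-everywhere xy k≤13 w u≢w))
  ... | no x≢u   =
    deep-everywhere (Deep-sym 𝒫 (deep-everywhere xy k≤13 u x≢u)) k≤13 w u≢w

-- Triangles of edges in a target of order 13

module _ (𝒫 : Palette n m) (H : MixedGraph n m 13)
         (deep : ∀ x y → x ≢ y → Deep 𝒫 H 2 x y) where
  open Palette 𝒫

  isEdge : Fin 13 → Fin 13 → ℕ
  isEdge x y = if does (link H x y ≟ᴸ τ 2F) then 1 else 0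

  isEdge-yes : ∀ {x y} → link H x y ≡ τ 2F → isEdge x y ≡ 1
  isEdge-yes e = cong (if_then 1 else 0) (dec-true (_ ≟ᴸ _) e)

  isEdge-no : ∀ {x y} → link H x y ≢ τ 2F → isEdge x y ≡ 0
  isEdge-no ¬e = cong (if_then 1 else 0) (dec-false (_ ≟ᴸ _) ¬e)

  edge-sym : ∀ {x y} → link H x y ≡ τ 2F → link H y x ≡ τ 2F
  edge-sym e = trans (MixedGraph.link-reverse H _ _) (trans (cong reverse e) τ-edge)

  other : ∀ (x : Fin 13) → ∃ λ y → x ≢ y
  other zero    = suc zero , λ ()
  other (suc x) = zero , λ ()

  base-at : ∀ x → ∃ λ (base : Fin 3 → Fin 13) →
            (∀ a → link H x (base a) ≡ τ a) × (∀ a → Deep 𝒫 H 1 x (base a))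
  base-at x = apex-base 𝒫 H (deep x (proj₁ (other x)) (proj₂ (other x)))

  -- Reindexed along the fan, the sum runs over `x` and four neighbours of each type, of which only
  -- those of type `2F` count.
  degree : ∀ x → sum (isEdge x) ≡ 4
  degree x = trans (sum-permute (isEdge x) (around-permutation ≤-refl)) (sum-cong-≗ count)
    where
    open Fan 𝒫 H x (proj₁ (base-at x)) (proj₁ (proj₂ (base-at x))) (proj₂ (proj₂ (base-at x)))

    ofType : Fin 3 → ℕ
    ofType a = if does (a ≟ 2F) then 1 else 0

    expected : Fin 13 → ℕ
    expected zero    = 0
    expected (suc i) = ofType (proj₁ (remQuot {3} 4 i))

    isEdge-ν : ∀ a j → isEdge x (ν a j) ≡ ofType a
    isEdge-ν a j with a ≟ 2F
    ... | yes refl = isEdge-yes (ν-link a j)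
    ... | no a≢2   = isEdge-no λ e → a≢2 (τ-injective (trans (sym (ν-link a j)) e))

    count : ∀ i → isEdge x (around i) ≡ expected i
    count zero    = isEdge-no λ e → τ-link⇒≢ 𝒫 H e refl
    count (suc i) = uncurry isEdge-ν (remQuot {3} 4 i)

  -- With `y` as the base of type `2F`, the neighbours of `x` of that type are `y` and three apices
  -- over `xy`. These have pairwise different types towards `y`, so just one of them has type `2F`.
  unique-apex : ∀ {x y} → link H x y ≡ τ 2F →
                ∃ λ z → (link H x z ≡ τ 2F × link H y z ≡ τ 2F) ×
                        (∀ w → link H x w ≡ τ 2F → link H y w ≡ τ 2F → w ≡ z)
  unique-apex {x} {y} xy = ν 2F (suc 2F) , (ν-link 2F (suc 2F) , yν 2F) , unique
    where
    base : Fin 3 → Fin 13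
    base 2F = y
    base a  = proj₁ (base-at x) a

    base-link : ∀ a → link H x (base a) ≡ τ a
    base-link 0F = proj₁ (proj₂ (base-at x)) 0F
    base-link 1F = proj₁ (proj₂ (base-at x)) 1F
    base-link 2F = xy

    base-deep : ∀ a → Deep 𝒫 H 1 x (base a)
    base-deep 0F = proj₂ (proj₂ (base-at x)) 0F
    base-deep 1F = proj₂ (proj₂ (base-at x)) 1F
    base-deep 2F = Deep-pred 𝒫 (deep x y (τ-link⇒≢ 𝒫 H xy))

    open Fan 𝒫 H x base base-link base-deep

    yν : ∀ b → link H y (ν 2F (suc b)) ≡ τ b
    yν = ν-base 2F

    unique : ∀ w → link H x w ≡ τ 2F → link H y w ≡ τ 2F → w ≡ ν 2F (suc 2F)
    unique w xw yw with neighbour ≤-refl w (τ-link⇒≢ 𝒫 H xw)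
    ... | a , i , refl with τ-injective (trans (sym (ν-link a i)) xw)
    unique w xw yw | a , zero  , refl | refl = contradiction refl (τ-link⇒≢ 𝒫 H yw)
    unique w xw yw | a , suc b , refl | refl =
      cong (λ b → ν 2F (suc b)) (τ-injective (trans (sym (yν b)) yw))

  triangle : Fin 13 → Fin 13 → Fin 13 → ℕ
  triangle x y z = isEdge x y * (isEdge y z * isEdge z x)

  triangles-on : ∀ x y → sum (triangle x y) ≡ isEdge x y
  triangles-on x y with link H x y ≟ᴸ τ 2F
  ... | no ¬xy = sum-replicate-zero 13
  ... | yes xy =
    let z , (xz , yz) , unique = unique-apex xy in
    trans (sum-single _ z λ w w≢z → trans (+-identityʳ _) (none-other w λ xw yw → w≢z (unique w xw yw)))
          (cong₂ (λ p q → p * q + 0) (isEdge-yes yz) (isEdge-yes (edge-sym xz)))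
    where
    none-other : ∀ w → (link H x w ≡ τ 2F → link H y w ≢ τ 2F) → isEdge y w * isEdge w x ≡ 0
    none-other w ¬both with link H y w ≟ᴸ τ 2F
    ... | no _   = refl
    ... | yes yw = trans (+-identityʳ _) (isEdge-no λ wx → ¬both (edge-sym wx) yw)

  triangle-distinct : ∀ x y z → x ≡ y ⊎ y ≡ z ⊎ z ≡ x → triangle x y z ≡ 0
  triangle-distinct x .x z (inj₁ refl) = cong (_* (isEdge x z * isEdge z x)) (isEdge-no λ e → τ-link⇒≢ 𝒫 H e refl)
  triangle-distinct x y .y (inj₂ (inj₁ refl)) =
    trans (cong (λ r → isEdge x y * (r * isEdge y x)) (isEdge-no λ e → τ-link⇒≢ 𝒫 H e refl))
          (*-zeroʳ (isEdge x y))
  triangle-distinct x y .x (inj₂ (inj₂ refl)) =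
    trans (cong (λ r → isEdge x y * (isEdge y x * r)) (isEdge-no λ e → τ-link⇒≢ 𝒫 H e refl))
          (trans (cong (isEdge x y *_) (*-zeroʳ (isEdge y x))) (*-zeroʳ (isEdge x y)))

  -- Selects the rotation that starts with the smallest vertex.
  first : Fin 13 → Fin 13 → Fin 13 → ℕ
  first x y z = if does (x <? y) then (if does (x <? z) then 1 else 0) else 0

  first-once : ∀ x y z → (x ≡ y ⊎ y ≡ z ⊎ z ≡ x) ⊎ first x y z + first y z x + first z x y ≡ 1
  first-once = from-yes (all? λ x → all? λ y → all? λ z →
    (x ≟ y ⊎-dec y ≟ z ⊎-dec z ≟ x) ⊎-dec (first x y z + first y z x + first z x y ℕ.≟ 1))

  3∣triangles : 3 ∣ sum³ triangle
  3∣triangles = 3∣sum³ first triangle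
    (λ x y z → solve 3 (λ p q r → q :* (r :* p) := p :* (q :* r)) refl
                 (isEdge x y) (isEdge y z) (isEdge z x))
    λ x y z → [ inj₁ ∘ triangle-distinct x y z , inj₂ ]′ (first-once x y z)
    where
    open +-*-Solver

  -- There are 13 · 4 ordered edges, that is 26 edges in both directions, and each has exactly one
  -- third vertex.
  52-triangles : sum³ triangle ≡ 52
  52-triangles = sum-cong-≗ λ x → trans (sum-cong-≗ (triangles-on x)) (degree x)

-- Four of the layers make every pair of vertices of H the image of a deep
-- edge, and the other two are used at these pairs.
no-small-target : ∀ (𝒫 : Palette n m) {k} (H : MixedGraph n m k) → k ≤ 13 →
                  ∀ {x y} → ¬ Deep 𝒫 H 6 x y
no-small-target 𝒫 H k≤13 xy
  with base , base-link , base-deep ← apex-base 𝒫 H xy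
  with refl ← ≤-antisym k≤13 (Fan.13≤k 𝒫 H _ base base-link base-deep)
  = from-no (3 ∣? 52) (subst (3 ∣_) (52-triangles 𝒫 H deep) (3∣triangles 𝒫 H deep))
  where
  deep = deep-all 𝒫 H k≤13 xy

-- Existence of the chromatic numbers

-- Covering `A` only up to `≈` lets functions be enumerated up to pointwise equality; `search`
-- therefore asks that the predicate respect `≈`.
record Enumeration (A : Set) (_≈_ : A → A → Set) : Set where
  field
    size     : ℕ
    at       : Fin size → A
    index    : A → Fin size
    at-index : ∀ a → at (index a) ≈ a

  search : ∀ {P : A → Set} → Decidable P → (∀ {a b} → a ≈ b → P b → P a) → Dec (∃ P)
  search P? resp = map′ (λ (i , p) → at i , p) (λ (a , p) → index a , resp (at-index a) p)
                        (any? (P? ∘ at))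

Fin-enumeration : ∀ k → Enumeration (Fin k) _≡_
Fin-enumeration k = record { size = k ; at = id ; index = id ; at-index = λ _ → refl }

function-enumeration : ∀ {A _≈_} k → Enumeration A _≈_ →
                       Enumeration (Fin k → A) (λ f g → ∀ i → f i ≈ g i)
function-enumeration {_≈_ = _≈_} k E = record
  { size     = size ^ k
  ; at       = λ c → at ∘ finToFun c
  ; index    = λ f → funToFin (index ∘ f)
  ; at-index = λ f i → subst (λ c → at c ≈ f i) (sym (finToFun-funToFin (index ∘ f) i)) (at-index (f i))
  }
  where open Enumeration E

Link-enumeration : ∀ n m → Enumeration (Link n m) _≡_
Link-enumeration n m = record
  { size     = 1 + (n + (n + m))
  ; at       = at
  ; index    = index
  ; at-index = at-index
  }
  where
  fromSum : Fin n ⊎ Fin (n + m) → Link n m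
  fromSum (inj₁ i) = arcTo i
  fromSum (inj₂ c) = [ arcFrom , edge ]′ (splitAt n c)

  at : Fin (1 + (n + (n + m))) → Link n m
  at zero    = none
  at (suc c) = fromSum (splitAt n c)

  index : Link n m → Fin (1 + (n + (n + m)))
  index none        = zero
  index (arcTo i)   = suc (join n _ (inj₁ i))
  index (arcFrom i) = suc (join n _ (inj₂ (join n m (inj₁ i))))
  index (edge j)    = suc (join n _ (inj₂ (join n m (inj₂ j))))

  at-index : ∀ l → at (index l) ≡ l
  at-index none        = refl
  at-index (arcTo i)   = cong fromSum (splitAt-join n (n + m) (inj₁ i))
  at-index (arcFrom i) = trans (cong fromSum (splitAt-join n (n + m) (inj₂ (join n m (inj₁ i)))))
                               (cong [ arcFrom , edge ]′ (splitAt-join n m (inj₁ i)))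
  at-index (edge j)    = trans (cong fromSum (splitAt-join n (n + m) (inj₂ (join n m (inj₂ j)))))
                               (cong [ arcFrom , edge ]′ (splitAt-join n m (inj₂ j)))

_≗ᴳ_ : MixedGraph n m v → MixedGraph n m v → Set
G ≗ᴳ G′ = ∀ x y → link G x y ≡ link G′ x y

-- The search runs over bare link functions, with the graph laws moved into the predicate `Q`.
anyGraph? : ∀ {P : MixedGraph n m v → Set} → Decidable P →
            (∀ {G G′} → G ≗ᴳ G′ → P G′ → P G) → Dec (∃ P)
anyGraph? {n} {m} {v} {P} P? resp = map′ from to (search Q? Q-resp)
  where
  Links = Fin v → Fin v → Link n m
  open Enumeration (function-enumeration v (function-enumeration v (Link-enumeration n m)))

  IsMixed : Links → Set
  IsMixed L = (∀ x → L x x ≡ none) × (∀ x y → L y x ≡ reverse (L x y))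

  graph : ∀ L → IsMixed L → MixedGraph n m v
  graph L (loopless , link-reverse) =
    record { link = L ; loopless = loopless ; link-reverse = link-reverse }

  Q : Links → Set
  Q L = ∃ λ (ok : IsMixed L) → P (graph L ok)

  from : ∃ Q → ∃ P
  from (L , ok , p) = graph L ok , p

  to : ∃ P → ∃ Q
  to (G , p) = link G , (MixedGraph.loopless G , MixedGraph.link-reverse G) , p

  Q? : Decidable Q
  Q? L with (all? λ x → L x x ≟ᴸ none) ×-dec (all? λ x → all? λ y → L y x ≟ᴸ reverse (L x y))
  ... | no ¬ok = no (¬ok ∘ proj₁)
  -- `resp` makes `P` independent of which proofs of the graph laws are used.
  ... | yes ok = map′ (ok ,_) (λ (_ , p) → resp (λ _ _ → refl) p) (P? (graph L ok))

  Q-resp : ∀ {L L′ : Links} → (∀ x y → L x y ≡ L′ x y) → Q L′ → Q L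
  Q-resp {L} {L′} eq ((loopless , link-reverse) , p) =
    ( (λ x → trans (eq x x) (loopless x))
    , (λ x y → trans (eq y x) (trans (link-reverse x y) (cong reverse (sym (eq x y))))))
    , resp eq p

_⟶?_ : (G : MixedGraph n m v) (H : MixedGraph n m w) → Dec (G ⟶ H)
_⟶?_ {v = v} {w = w} G H =
  map′ (λ (f , pres) → mk⟶ f pres) (λ f → _⟶_.map f , ⟶-link f)
       (search (λ f → all? λ x → all? λ y →
                  T? (joined (link G x y)) →-dec (link H (f x) (f y) ≟ᴸ link G x y))
               (λ eq pres x y j → trans (cong₂ (link H) (eq x) (eq y)) (pres x y j)))
  where open Enumeration (function-enumeration v (Fin-enumeration w))

⟶-respˡ : {G G′ : MixedGraph n m v} {H : MixedGraph n m w} → G ≗ᴳ G′ → G′ ⟶ H → G ⟶ H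
⟶-respˡ eq f = mk⟶ (_⟶_.map f) λ x y j →
  trans (⟶-link f x y (subst (T ∘ joined) (eq x y) j)) (sym (eq x y))

⟶-respʳ : {G : MixedGraph n m v} {H H′ : MixedGraph n m w} → H ≗ᴳ H′ → G ⟶ H′ → G ⟶ H
⟶-respʳ eq f = mk⟶ (_⟶_.map f) λ x y j → trans (eq _ _) (⟶-link f x y j)

targetOrder? : (G : MixedGraph n m v) → Decidable (TargetOrder G)
targetOrder? G k = anyGraph? (G ⟶?_) ⟶-respʳ

module _ {P : ℕ → Set} (P? : Decidable P) where

  minimum? : Decidable (IsMinimum P)
  minimum? k with P? k | anyUpTo? P? k
  ... | no ¬p | _                   = no (¬p ∘ proj₁)
  ... | yes p | yes (j , j<k , Pj)  = no λ (_ , min) → <⇒≱ j<k (min j Pj)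
  ... | yes p | no none-below       = yes (p , λ j Pj → ≮⇒≥ λ j<k → none-below (j , j<k , Pj))

  minimum : ∀ {k} → P k → ∃ (IsMinimum P)
  minimum {k} = go k k ≤-refl
    where
    -- The bound `b` on `k` decreases with every smaller witness, which makes the descent terminate.
    go : ∀ b k → k ≤ b → P k → ∃ (IsMinimum P)
    go b k k≤b p with anyUpTo? P? k
    ... | no none-below = k , p , λ j Pj → ≮⇒≥ λ j<k → none-below (j , j<k , Pj)
    go zero    _ z≤n p | yes (_ , () , _)
    go (suc b) k k≤b p | yes (j , j<k , Pj) = go b j (≤-pred (≤-trans j<k k≤b)) Pj

-- In continuation-passing style, so that it serves both for a decidable P
-- and, with R = ⊥, for the double negation of an arbitrary one.
climb : ∀ {P : ℕ → Set} {R : Set} {b} → (∀ j → P j → j ≤ b) →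
        (∀ k → (Dec (∃ λ j → k < j × P j) → R) → R) →
        (∃ (IsMaximum P) → R) → ∀ {k} → P k → R
climb {P} {R} {b} bounded above return {k} = go b k (m≤n+m b k)
  where
  -- `d` bounds the number of climbs still possible below `b`.
  go : ∀ d k → b ≤ k + d → P k → R
  go d k b≤k+d p = above k (step d b≤k+d)
    where
    step : ∀ d → b ≤ k + d → Dec (∃ λ j → k < j × P j) → R
    step _ _ (no none-above) = return (k , p , λ j Pj → ≮⇒≥ λ k<j → none-above (j , k<j , Pj))
    step zero    b≤k+0 (yes (j , k<j , Pj)) =
      contradiction (≤-trans (bounded j Pj) (≤-trans b≤k+0 (≤-reflexive (+-identityʳ k))))
                    (<⇒≱ k<j)
    step (suc d) b≤k+d (yes (j , k<j , Pj)) =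
      go d j (≤-trans b≤k+d (≤-trans (≤-reflexive (+-suc k d)) (+-monoˡ-≤ d k<j))) Pj

maximum : ∀ {P : ℕ → Set} → Decidable P → ∀ {b} → (∀ j → P j → j ≤ b) → ∀ {k} → P k → ∃ (IsMaximum P)
maximum {P} P? {b} bounded = climb bounded (λ k return → return (above? k)) id
  where
  above? : ∀ k → Dec (∃ λ j → k < j × P j)
  above? k = map′ (λ (j , _ , above) → j , above)
                  (λ (j , k<j , Pj) → j , s≤s (bounded j Pj) , k<j , Pj)
                  (anyUpTo? (λ j → k ℕ.<? j ×-dec P? j) (suc b))

-- Meant for `χ-member`, which ranges over graphs of every order and is not decided here; the
-- finitely many case distinctions are made under double negation.
¬¬-maximum : ∀ {P : ℕ → Set} {b} → (∀ j → P j → j ≤ b) → ∀ {k} → P k → ¬ ¬ ∃ (IsMaximum P)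
¬¬-maximum bounded p no-maximum = climb bounded (λ _ → ¬¬-excluded-middle) no-maximum p

targetOrder-self : (G : MixedGraph n m v) → TargetOrder G v
targetOrder-self G = G , mk⟶ id λ _ _ _ → refl

χ-mixed-exists : (G : MixedGraph n m v) → ∃ (χ-mixed G)
χ-mixed-exists G = minimum (targetOrder? G) (targetOrder-self G)

-- Every graph maps to itself, so the attained values are at most `v`, and all graphs on `v`
-- vertices can be searched.
χ-simple-exists : (G : MixedGraph n m v) → ∃ (χ-simple n m (und G))
χ-simple-exists {n} {m} {v} G =
  maximum attained? bounded (G , (λ _ _ → refl) , proj₂ (χ-mixed-exists G))
  where
  S = und G
  Attained : ℕ → Set
  Attained k = ∃ λ (G′ : MixedGraph n m v) → und G′ ≐ S × χ-mixed G′ k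

  attained? : Decidable Attained
  attained? k = anyGraph?
    (λ G′ → (all? λ x → all? λ y → SimpleGraph.adj (und G′) x y ≟ᵇ SimpleGraph.adj S x y)
            ×-dec minimum? (targetOrder? G′) k)
    (λ eq (und-eq , (H , f) , min) →
      (λ x y → trans (cong joined (eq x y)) (und-eq x y)) ,
      (H , ⟶-respˡ eq f) ,
      λ j (H′ , f′) → min j (H′ , ⟶-respˡ (λ x y → sym (eq x y)) f′))

  bounded : ∀ k → Attained k → k ≤ v
  bounded k (G′ , _ , _ , min) = min v (targetOrder-self G′)

-- Targets of orders 15 and 21

module _ {h} (𝒫 : Palette n m) (H : MixedGraph n m h) where
  open Palette 𝒫

  Apices : Set
  Apices = ∀ p q → T (joined (link H p q)) → ∀ a b → ∃ λ c → link H p c ≡ τ a × link H q c ≡ τ b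

  apices? : Dec Apices
  apices? = all? λ p → all? λ q → T? (joined (link H p q)) →-dec
            all? λ a → all? λ b → any? λ c → (link H p c ≟ᴸ τ a) ×-dec (link H q c ≟ᴸ τ b)

  -- A single prescribed link is obtained from a common neighbour of `p` and any vertex joined to
  -- it.
  apices⇒extensible : Fin h → (∀ p → ∃ λ q → T (joined (link H p q))) → Apices → Extensible 𝒫 H
  apices⇒extensible root neighbour apices = record
    { root = root
    ; ext₁ = λ p a → let q , pq = neighbour p
                         c , pc , _ = apices p q pq a a
                     in  c , pc
    ; ext₂ = apices
    }

-- F₄, with 2F a primitive element.
infixl 6 _⊕_
infixl 7 _⊗_

_⊕_ : Fin 4 → Fin 4 → Fin 4
0F ⊕ y  = y
x  ⊕ 0F = x
1F ⊕ 1F = 0F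
1F ⊕ 2F = 3F
1F ⊕ 3F = 2F
2F ⊕ 1F = 3F
2F ⊕ 2F = 0F
2F ⊕ 3F = 1F
3F ⊕ 1F = 2F
3F ⊕ 2F = 1F
3F ⊕ 3F = 0F

_⊗_ : Fin 4 → Fin 4 → Fin 4
0F ⊗ y  = 0F
x  ⊗ 0F = 0F
1F ⊗ y  = y
x  ⊗ 1F = x
2F ⊗ 2F = 3F
2F ⊗ 3F = 1F
3F ⊗ 2F = 1F
3F ⊗ 3F = 2F

-- The nonzero vectors of F₄², joined according to their determinant, which
-- is symmetric in characteristic 2.  Independent p and q and prescribed
-- determinants a and b determine c by Cramer's rule.
H₁₅ : MixedGraph 0 3 15
H₁₅ = record
  { link         = λ p q → type (det (vector p) (vector q))
  ; loopless     = from-yes (all? λ p → type (det (vector p) (vector p)) ≟ᴸ none)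
  ; link-reverse = from-yes (all? λ p → all? λ q →
                     type (det (vector q) (vector p)) ≟ᴸ reverse (type (det (vector p) (vector q))))
  }
  where
  vector : Fin 15 → Fin 4 × Fin 4
  -- The shift by one skips the zero vector.
  vector p = remQuot {4} 4 (suc p)

  det : Fin 4 × Fin 4 → Fin 4 × Fin 4 → Fin 4
  det (x₁ , x₂) (y₁ , y₂) = x₁ ⊗ y₂ ⊕ x₂ ⊗ y₁

  type : Fin 4 → Link 0 3
  type zero    = none
  type (suc d) = edge d

-- The Cayley graph of the group Z₇ ⋊ Z₃, where the generator of Z₃ acts as
-- multiplication by 2; the connection set was found by computer search.
-- (o , i) stands for the product of i ∈ Z₇ and o ∈ Z₃, in this order.
H₂₁ : MixedGraph 1 1 21
H₂₁ = record
  { link         = λ p q → between (remQuot {3} 7 p) (remQuot {3} 7 q)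
  ; loopless     = from-yes (all? λ p → between (remQuot {3} 7 p) (remQuot {3} 7 p) ≟ᴸ none)
  ; link-reverse = from-yes (all? λ p → all? λ q →
                     between (remQuot {3} 7 q) (remQuot {3} 7 p) ≟ᴸ
                     reverse (between (remQuot {3} 7 p) (remQuot {3} 7 q)))
  }
  where
  ● ▸ ◂ ─ : Link 1 1
  ● = none
  ▸ = arcTo zero
  ◂ = arcFrom zero
  ─ = edge zero

  from-unit : Vec (Vec (Link 1 1) 7) 3
  from-unit = (● ∷ ▸ ∷ ▸ ∷ ▸ ∷ ◂ ∷ ◂ ∷ ◂ ∷ [])
            ∷ (▸ ∷ ▸ ∷ ─ ∷ ─ ∷ ◂ ∷ ▸ ∷ ─ ∷ [])
            ∷ (◂ ∷ ◂ ∷ ─ ∷ ◂ ∷ ─ ∷ ▸ ∷ ─ ∷ []) ∷ []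

  -- The inverses modulo 7 of the powers 1, 2, 4 of 2.
  inverse-power : Fin 3 → ℕ
  inverse-power 0F = 1
  inverse-power 1F = 4
  inverse-power 2F = 2

  -- The link is the one from the unit to the quotient of `(p , j)` by `(o , i)` on the left, with
  -- components p - o and 2^(-o) · (j - i). Adding 3 and 7 keeps the differences in `ℕ`.
  between : Fin 3 × Fin 7 → Fin 3 × Fin 7 → Link 1 1
  between (o , i) (p , j) =
    lookup (lookup from-unit ((toℕ p + (3 ∸ toℕ o)) mod 3))
           ((inverse-power o * (toℕ j + (7 ∸ toℕ i))) mod 7)

H₁₅-extensible : Extensible palette₀₃ H₁₅
H₁₅-extensible = apices⇒extensible palette₀₃ H₁₅ zero
  (from-yes (all? λ p → any? λ q → T? (joined (link H₁₅ p q))))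
  (from-yes (apices? palette₀₃ H₁₅))

H₂₁-extensible : Extensible palette₁₁ H₂₁
H₂₁-extensible = apices⇒extensible palette₁₁ H₂₁ zero
  (from-yes (all? λ p → any? λ q → T? (joined (link H₂₁ p q))))
  (from-yes (apices? palette₁₁ H₂₁))

-- The two bounds

member-upper-bound : ∀ {𝒫 : Palette n m} {h} {H : MixedGraph n m h} → Extensible 𝒫 H →
                     ∀ k → χ-member n m Partial2Tree k → k ≤ h
member-upper-bound ext k (_ , S , p2t , (G , G≐S , _ , min) , _) =
  min _ (_ , partial2tree-⟶ ext G G≐S p2t)

-- A smallest target of the six-layer graph has order `j`, at least 14, and the value `k` of its
-- underlying simple graph is at least `j`.
member-lower-bound : Palette n m → ∃ λ k → χ-member n m Partial2Tree k × 14 ≤ k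
member-lower-bound 𝒫 =
  let v , G , p2t , deep = deepGraph 𝒫 6
      k , maximal        = χ-simple-exists G
      j , χj@((H , f) , _) = χ-mixed-exists G
      14≤j : 14 ≤ j
      14≤j = ≰⇒> λ j≤13 → no-small-target 𝒫 H j≤13 (proj₂ (proj₂ (deep H f)))
  in  k , (v , und G , p2t , maximal) , ≤-trans 14≤j (proj₂ maximal j (G , (λ _ _ → refl) , χj))

between-14-and : ∀ {𝒫 : Palette n m} {h} {H : MixedGraph n m h} → Extensible 𝒫 H →
                 χ-family-between n m Partial2Tree 14 h
between-14-and {𝒫 = 𝒫} ext =
  let k₀ , member , 14≤k₀ = member-lower-bound 𝒫
      bounded = member-upper-bound ext
  in  (λ none′ → ¬¬-maximum bounded member λ (k , member-k , greatest) →
        none′ (k , (member-k , greatest) , ≤-trans 14≤k₀ (greatest k₀ member) , bounded k member-k)) ,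
      member-lower-bound 𝒫

theorem4p1 : χ-family-between 0 3 Partial2Tree 14 15 × χ-family-between 1 1 Partial2Tree 14 21
theorem4p1 = between-14-and H₁₅-extensible , between-14-and H₂₁-extensible
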